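{- Let $\delta>0$ and let $p\in\mathbb{Z}[x]$ satisfy $\lim_{x\to+\infty}p(x)=+\infty$. Suppose that $p(n)$ is even for some $n\in\mathbb{N}$. Then there exist $b,d\in\mathbb{N}$ such that, for every $A\subseteq\mathbb{N}$ satisfying $$\overline{d}_{b+d\mathbb{N}}(A):=\limsup_{N\to\infty}\frac{\left|A\cap\{b+d,b+2d,\dots,b+Nd\}\right|}{N}>\delta,$$ there exist distinct $x,y\in A$ such that $x+y=p(n)$ for some $n\in\mathbb{N}$.
   Context: $\mathbb{N}=\{1,2,\dots\}$. -}

module Defs where

open import Data.Fin using (toℕ)
open import Data.Fin.Subset using (Subset; ∣_∣) renaming (_∈_ to _∈ₛ_)
open import Data.Integer as ℤ using (ℤ; +_; 0ℤ)
open import Data.List using (List; foldr)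
open import Data.Nat as ℕ using (ℕ; suc)
open import Data.Product using (∃-syntax; Σ-syntax; _×_; _,_)
open import Data.Rational as ℚ using (ℚ; _/_)
open import Data.Rational.Properties using (<-trans; <-dense)
open import Level using (0ℓ)
open import Relation.Unary using (Pred; _∈_; _∉_)

-- Coefficients are listed from the constant term upwards; trailing zeros are
-- allowed.

ℤ[x] : Set
ℤ[x] = List ℤ

eval : ℤ[x] → ℤ → ℤ
eval p x = foldr (λ a r → a ℤ.+ x ℤ.* r) 0ℤ p

-- The variable runs over ℤ.  For f = eval p, divergence along the real line
-- restricts to this (and is equivalent to it).

TendsTo+∞ : (ℤ → ℤ) → Set
TendsTo+∞ f = ∀ (M : ℤ) → ∃[ X ] (∀ x → X ℤ.≤ x → M ℤ.≤ f x)

-- Extended reals as lower Dedekind cuts: the cut of r is { q ∈ ℚ ∣ q < r }.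
-- The empty cut is -∞ and the full cut is +∞.

record ExtReal : Set₁ where
  field
    Lower   : Pred ℚ 0ℓ
    down    : ∀ {q r} → q ℚ.< r → r ∈ Lower → q ∈ Lower
    rounded : ∀ {q} → q ∈ Lower → ∃[ r ] (q ℚ.< r × r ∈ Lower)

open ExtReal

record ℝ : Set₁ where
  field
    ext       : ExtReal
    inhabited : ∃[ q ] q ∈ Lower ext
    bounded   : ∃[ q ] q ∉ Lower ext

open ℝ public using (ext)

infix 4 _<ᵉ_

_<ᵉ_ : ExtReal → ExtReal → Set
x <ᵉ y = ∃[ q ] (q ∉ Lower x × q ∈ Lower y)

fromℚ : ℚ → ExtReal
fromℚ r .Lower q = q ℚ.< r
fromℚ r .down    = <-trans
fromℚ r .rounded q<r with s , q<s , s<r ← <-dense q<r = s , q<s , s<r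

0ᵉ : ExtReal
0ᵉ = fromℚ ℚ.0ℚ

sup : {I : Set} → (I → ExtReal) → ExtReal
sup f .Lower q           = ∃[ i ] q ∈ Lower (f i)
sup f .down q<r (i , r∈) = i , down (f i) q<r r∈
sup f .rounded (i , q∈) with r , q<r , r∈ ← rounded (f i) q∈ = r , q<r , i , r∈

-- The bare intersection of cuts may have a greatest element, which is removed.

inf : {I : Set} → (I → ExtReal) → ExtReal
inf f .Lower q                    = ∃[ r ] (q ℚ.< r × (∀ i → r ∈ Lower (f i)))
inf f .down q<r (s , r<s , s∈)    = s , <-trans q<r r<s , s∈
inf f .rounded (s , q<s , s∈) with t , q<t , t<s ← <-dense q<s = t , q<t , s , t<s , s∈

limsup : (ℕ → ExtReal) → ExtReal
limsup a = inf λ (M : ℕ) → sup λ ((N , _) : ∃[ N ] M ℕ.≤ N) → a N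

-- The subsets of A ∩ {b+d, b+2d, …, b+Nd}, where i : Fin N stands for
-- b + (i+1)d.

FiniteSubsetOf : Pred ℕ 0ℓ → (b d N : ℕ) → Set
FiniteSubsetOf A b d N =
  Σ[ U ∈ Subset N ] (∀ {i} → i ∈ₛ U → b ℕ.+ suc (toℕ i) ℕ.* d ∈ A)

-- ∣A ∩ {b+d, …, b+Nd}∣ / N with N = k+1.  Since A need not be decidable, the
-- cardinality is taken as the largest size of a subset of the intersection;
-- for d ≥ 1 the points b + (i+1)d are distinct.

relativeFrequency : Pred ℕ 0ℓ → (b d k : ℕ) → ExtReal
relativeFrequency A b d k =
  sup λ ((U , _) : FiniteSubsetOf A b d (suc k)) → fromℚ (+ ∣ U ∣ / suc k)

upperDensity : (b d : ℕ) → Pred ℕ 0ℓ → ExtReal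
upperDensity b d A = limsup (relativeFrequency A b d)

-- Write p(n* + t) = 2b + t R(t) with natural coefficients and c = R(0) ≠ 0, and
-- put d = c² E.  Then p(n* + c E m) = 2b + d q(m) with q(m) ≡ m modulo E, so it
-- suffices that a set of density > 1/K contains distinct i, j with i + j = q(m).
--
-- Iterated van der Corput differencing shows that averages of a function along
-- a polynomial of degree k change little in ℓ² under translation by multiples of
-- D μ, where D depends only on k and K and μ is k! times the leading coefficient.
-- If E is divisible enough, D μ divides a power Γ of E, and Hensel lifting makes q
-- a bijection modulo Γ.  Hence the solutions of i + j = q(m) are about as frequent
-- as those of i + j ≡ q(m) modulo Γ with q(m) - i - j in a short interval, of which
-- there are many.  Everything is done for functions of period W, so that ℓ² norms
-- are finite sums and translations are isometries.

module Submission where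

open import Defs
open import Data.Integer using (+_)
open import Data.Integer.Divisibility using (_∣_)
open import Data.Nat using (ℕ; _+_; NonZero)
open import Data.Product using (∃-syntax; _×_)
open import Level using (0ℓ)
open import Relation.Binary.PropositionalEquality using (_≡_; _≢_)
open import Relation.Unary using (Pred; _∈_; _⊆_)

open import Data.Bool as Bool using (Bool; true; false)
open import Data.Empty using (⊥; ⊥-elim)
open import Data.Fin using (toℕ; zero; suc)
open import Data.Fin.Subset as Subset using (Subset)
open import Data.Integer as ℤ using (ℤ; 0ℤ; 1ℤ)
import Data.Integer.Divisibility.Signed as Signed
import Data.Integer.Properties as ℤ
open import Data.Integer.Tactic.RingSolver using (solve-∀)
open import Data.List using ([]; _∷_)
open import Data.Nat as ℕ using (zero; suc; z≤n; s≤s; _!)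
open import Data.Nat.Divisibility as ℕ∣ using () renaming (_∣_ to _∣ℕ_)
open import Data.Nat.DivMod using (_/_; _%_; m≡m%n+[m/n]*n; m%n<n; m/n*n≤m; [m+kn]%n≡m%n; m<n⇒m%n≡m; m≥n⇒m/n>0)
import Data.Nat.Properties as ℕ
import Data.Nat.Tactic.RingSolver as ℕ-Ring
open import Data.Product using (_,_; proj₁; proj₂)
open import Data.Rational as ℚ using (ℚ; mkℚ)
import Data.Rational.Properties as ℚ
open import Data.Rational.Unnormalised using (mkℚᵘ)
import Data.Rational.Unnormalised.Properties as ℚᵘ
open import Data.Sum using (_⊎_; inj₁; inj₂)
open import Data.Vec using ([]; _∷_; here; there)
open import Relation.Binary using (tri<; tri≈; tri>)
open import Relation.Binary.PropositionalEquality using (refl; sym; trans; cong; cong₂; subst; subst₂; module ≡-Reasoning)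
open import Relation.Nullary using (yes; no; _×-dec_; ¬?)

-- Solutions with `y = z` must not be mistaken for the wanted ones, so the count is comparative. If
-- there are no others, `pairing f` is at most `M`, one for each argument `m`, whereas the pairings
-- with the `G` translates `F r` sum to at least `S²`. Since `M G` is bounded by a multiple of `N`,
-- and `N` by `K S`, their average is at least a constant times `M S`. Almost invariance puts
-- `pairing (F r)` at most `M S / κ` above `pairing f`, which is incompatible with this once `κ` is
-- large against the constants and `N` is large.
--
-- The choice of moduli looks circular: `E` must make `D μ` divide a power of itself, but `μ`
-- contains the leading coefficient of `q`, which depends on `E`. The circle breaks because `D` is
-- uniform in the polynomial, and because that leading coefficient divides `E^j ℓ` for some `j`,
-- where `ℓ` is the leading coefficient of `R` and is fixed beforehand.

≤-add : ∀ {i j d} → 0ℤ ℤ.≤ d → i ℤ.+ d ≡ j → i ℤ.≤ j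
≤-add {i} 0≤d refl = subst (ℤ._≤ i ℤ.+ _) (ℤ.+-identityʳ i) (ℤ.+-monoʳ-≤ i 0≤d)

0≤i*i : ∀ i → 0ℤ ℤ.≤ i ℤ.* i
0≤i*i (+ n)      = subst (0ℤ ℤ.≤_) (ℤ.pos-* n n) (ℤ.+≤+ z≤n)
0≤i*i ℤ.-[1+ n ] = ℤ.+≤+ z≤n

*-monoˡ-≤-ℕ : ∀ n {i j} → i ℤ.≤ j → + n ℤ.* i ℤ.≤ + n ℤ.* j
*-monoˡ-≤-ℕ n = ℤ.*-monoˡ-≤-nonNeg (+ n)

0≤n*i : ∀ n {i} → 0ℤ ℤ.≤ i → 0ℤ ℤ.≤ + n ℤ.* i
0≤n*i n {i} 0≤i = subst (ℤ._≤ + n ℤ.* i) (ℤ.*-zeroʳ (+ n)) (*-monoˡ-≤-ℕ n 0≤i)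

0≤i+j : ∀ {i j} → 0ℤ ℤ.≤ i → 0ℤ ℤ.≤ j → 0ℤ ℤ.≤ i ℤ.+ j
0≤i+j = ℤ.+-mono-≤

2ij≤i²+j² : ∀ i j → + 2 ℤ.* (i ℤ.* j) ℤ.≤ i ℤ.* i ℤ.+ j ℤ.* j
2ij≤i²+j² i j = ≤-add (0≤i*i (i ℤ.- j)) (lemma i j)
  where
  lemma : ∀ i j → + 2 ℤ.* (i ℤ.* j) ℤ.+ (i ℤ.- j) ℤ.* (i ℤ.- j) ≡ i ℤ.* i ℤ.+ j ℤ.* j
  lemma = solve-∀

-- Finite sums of integers

∑ : ℕ → (ℕ → ℤ) → ℤ
∑ zero    f = 0ℤ
∑ (suc n) f = ∑ n f ℤ.+ f n

∑-cong< : ∀ n {f g} → (∀ i → i ℕ.< n → f i ≡ g i) → ∑ n f ≡ ∑ n g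
∑-cong< zero    f≗g = refl
∑-cong< (suc n) f≗g = cong₂ ℤ._+_ (∑-cong< n λ i i<n → f≗g i (ℕ.m≤n⇒m≤1+n i<n)) (f≗g n ℕ.≤-refl)

∑-cong : ∀ n {f g} → (∀ i → f i ≡ g i) → ∑ n f ≡ ∑ n g
∑-cong n f≗g = ∑-cong< n λ i _ → f≗g i

∑-mono : ∀ n {f g} → (∀ i → i ℕ.< n → f i ℤ.≤ g i) → ∑ n f ℤ.≤ ∑ n g
∑-mono zero    f≤g = ℤ.≤-refl
∑-mono (suc n) f≤g = ℤ.+-mono-≤ (∑-mono n λ i i<n → f≤g i (ℕ.m≤n⇒m≤1+n i<n)) (f≤g n ℕ.≤-refl)

∑-const : ∀ n c → ∑ n (λ _ → c) ≡ + n ℤ.* c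
∑-const zero    c = sym (ℤ.*-zeroˡ c)
∑-const (suc n) c = trans (cong (ℤ._+ c) (∑-const n c)) (lemma (+ n) c)
  where
  lemma : ∀ n c → n ℤ.* c ℤ.+ c ≡ (1ℤ ℤ.+ n) ℤ.* c
  lemma = solve-∀

∑-nonneg : ∀ n {f} → (∀ i → 0ℤ ℤ.≤ f i) → 0ℤ ℤ.≤ ∑ n f
∑-nonneg zero    0≤f = ℤ.≤-refl
∑-nonneg (suc n) 0≤f = 0≤i+j (∑-nonneg n 0≤f) (0≤f n)

∑-+ : ∀ n f g → ∑ n (λ i → f i ℤ.+ g i) ≡ ∑ n f ℤ.+ ∑ n g
∑-+ zero    f g = refl
∑-+ (suc n) f g = trans (cong (ℤ._+ (f n ℤ.+ g n)) (∑-+ n f g)) (lemma (∑ n f) (∑ n g) (f n) (g n))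
  where
  lemma : ∀ a b c d → (a ℤ.+ b) ℤ.+ (c ℤ.+ d) ≡ (a ℤ.+ c) ℤ.+ (b ℤ.+ d)
  lemma = solve-∀

∑-*ˡ : ∀ n c f → c ℤ.* ∑ n f ≡ ∑ n (λ i → c ℤ.* f i)
∑-*ˡ zero    c f = ℤ.*-zeroʳ c
∑-*ˡ (suc n) c f = trans (ℤ.*-distribˡ-+ c (∑ n f) (f n)) (cong (ℤ._+ c ℤ.* f n) (∑-*ˡ n c f))

∑-neg : ∀ n f → ∑ n (λ i → ℤ.- f i) ≡ ℤ.- ∑ n f
∑-neg zero    f = refl
∑-neg (suc n) f = trans (cong (ℤ._- f n) (∑-neg n f)) (sym (ℤ.neg-distrib-+ (∑ n f) (f n)))

∑-- : ∀ n f g → ∑ n (λ i → f i ℤ.- g i) ≡ ∑ n f ℤ.- ∑ n g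
∑-- n f g = trans (∑-+ n f (λ i → ℤ.- g i)) (cong (λ t → ∑ n f ℤ.+ t) (∑-neg n g))

∑-swap : ∀ m n (f : ℕ → ℕ → ℤ) → ∑ m (λ i → ∑ n (f i)) ≡ ∑ n (λ j → ∑ m (λ i → f i j))
∑-swap zero    n f = sym (trans (∑-const n 0ℤ) (ℤ.*-zeroʳ (+ n)))
∑-swap (suc m) n f = trans (cong (ℤ._+ ∑ n (f m)) (∑-swap m n f)) (sym (∑-+ n (λ j → ∑ m (λ i → f i j)) (f m)))

∑-split : ∀ m n f → ∑ (m + n) f ≡ ∑ m f ℤ.+ ∑ n (λ i → f (m + i))
∑-split m zero    f = trans (cong (λ k → ∑ k f) (ℕ.+-identityʳ m)) (sym (ℤ.+-identityʳ (∑ m f)))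
∑-split m (suc n) f = begin
  ∑ (m + suc n) f                                  ≡⟨ cong (λ k → ∑ k f) (ℕ.+-suc m n) ⟩
  ∑ (m + n) f ℤ.+ f (m + n)                        ≡⟨ cong (ℤ._+ f (m + n)) (∑-split m n f) ⟩
  ∑ m f ℤ.+ ∑ n (λ i → f (m + i)) ℤ.+ f (m + n)    ≡⟨ ℤ.+-assoc (∑ m f) _ _ ⟩
  ∑ m f ℤ.+ ∑ (suc n) (λ i → f (m + i))            ∎
  where open ≡-Reasoning

∑-suc : ∀ n (f : ℕ → ℤ) → ∑ (suc n) f ≡ f 0 ℤ.+ ∑ n (λ i → f (suc i))
∑-suc n f = trans (∑-split 1 n f) (cong (ℤ._+ ∑ n (λ i → f (suc i))) (ℤ.+-identityˡ (f 0)))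

∑-reverse : ∀ n (f : ℕ → ℤ) → ∑ n (λ i → f (n ℕ.∸ i)) ≡ ∑ n (λ i → f (suc i))
∑-reverse zero    f = refl
∑-reverse (suc n) f = begin
  ∑ (suc n) (λ i → f (suc n ℕ.∸ i))             ≡⟨ ∑-suc n (λ i → f (suc n ℕ.∸ i)) ⟩
  f (suc n) ℤ.+ ∑ n (λ i → f (n ℕ.∸ i))         ≡⟨ cong (λ t → f (suc n) ℤ.+ t) (∑-reverse n f) ⟩
  f (suc n) ℤ.+ ∑ n (λ i → f (suc i))           ≡⟨ ℤ.+-comm (f (suc n)) (∑ n (λ i → f (suc i))) ⟩
  ∑ (suc n) (λ i → f (suc i))                   ∎
  where open ≡-Reasoning

-- Only the two boundary blocks of length `r` survive the subtraction. Splitting the sum over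
-- `M + r` terms in both orders also covers `r > M`.
∑-window : ∀ M r f → ∑ M f ℤ.- ∑ M (λ i → f (r + i)) ≡ ∑ r f ℤ.- ∑ r (λ i → f (M + i))
∑-window M r f = lemma (∑ M f) (∑ r (λ i → f (M + i))) (∑ r f) (∑ M (λ i → f (r + i))) (begin
  ∑ M f ℤ.+ ∑ r (λ i → f (M + i))  ≡⟨ ∑-split M r f ⟨
  ∑ (M + r) f                      ≡⟨ cong (λ k → ∑ k f) (ℕ.+-comm M r) ⟩
  ∑ (r + M) f                      ≡⟨ ∑-split r M f ⟩
  ∑ r f ℤ.+ ∑ M (λ i → f (r + i))  ∎)
  where
  open ≡-Reasoning
  cancel : ∀ a b c → a ℤ.+ b ℤ.- (b ℤ.+ c) ≡ a ℤ.- c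
  cancel = solve-∀
  cancel′ : ∀ a b c → c ℤ.+ a ℤ.- (b ℤ.+ a) ≡ c ℤ.- b
  cancel′ = solve-∀
  lemma : ∀ a b c d → a ℤ.+ b ≡ c ℤ.+ d → a ℤ.- d ≡ c ℤ.- b
  lemma a b c d eq = begin
    a ℤ.- d                  ≡⟨ cancel a b d ⟨
    a ℤ.+ b ℤ.- (b ℤ.+ d)    ≡⟨ cong (ℤ._- (b ℤ.+ d)) eq ⟩
    c ℤ.+ d ℤ.- (b ℤ.+ d)    ≡⟨ cancel′ d b c ⟩
    c ℤ.- b                  ∎

∑-cauchy-schwarz : ∀ n f → ∑ n f ℤ.* ∑ n f ℤ.≤ + n ℤ.* ∑ n (λ i → f i ℤ.* f i)
∑-cauchy-schwarz zero    f = ℤ.≤-refl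
∑-cauchy-schwarz (suc n) f = begin
  (s ℤ.+ a) ℤ.* (s ℤ.+ a)                               ≡⟨ expand s a ⟩
  s ℤ.* s ℤ.+ + 2 ℤ.* a ℤ.* s ℤ.+ a ℤ.* a               ≤⟨ ℤ.+-monoˡ-≤ (a ℤ.* a) (ℤ.+-mono-≤ (∑-cauchy-schwarz n f) cross) ⟩
  + n ℤ.* q ℤ.+ (q ℤ.+ + n ℤ.* (a ℤ.* a)) ℤ.+ a ℤ.* a   ≡⟨ collect (+ n) q (a ℤ.* a) ⟩
  (1ℤ ℤ.+ + n) ℤ.* (q ℤ.+ a ℤ.* a)                      ∎
  where
  open ℤ.≤-Reasoning
  s = ∑ n f
  a = f n
  q = ∑ n (λ i → f i ℤ.* f i)
  expand : ∀ s a → (s ℤ.+ a) ℤ.* (s ℤ.+ a) ≡ s ℤ.* s ℤ.+ + 2 ℤ.* a ℤ.* s ℤ.+ a ℤ.* a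
  expand = solve-∀
  collect : ∀ n q b → n ℤ.* q ℤ.+ (q ℤ.+ n ℤ.* b) ℤ.+ b ≡ (1ℤ ℤ.+ n) ℤ.* (q ℤ.+ b)
  collect = solve-∀
  swap : ∀ a b → + 2 ℤ.* a ℤ.* b ≡ + 2 ℤ.* (b ℤ.* a)
  swap = solve-∀
  cross : + 2 ℤ.* a ℤ.* s ℤ.≤ q ℤ.+ + n ℤ.* (a ℤ.* a)
  cross = begin
    + 2 ℤ.* a ℤ.* s                            ≡⟨ ∑-*ˡ n (+ 2 ℤ.* a) f ⟩
    ∑ n (λ i → + 2 ℤ.* a ℤ.* f i)              ≤⟨ ∑-mono n (λ i _ → ℤ.≤-trans (ℤ.≤-reflexive (swap a (f i))) (2ij≤i²+j² (f i) a)) ⟩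
    ∑ n (λ i → f i ℤ.* f i ℤ.+ a ℤ.* a)        ≡⟨ ∑-+ n _ _ ⟩
    q ℤ.+ ∑ n (λ _ → a ℤ.* a)                  ≡⟨ cong (λ t → q ℤ.+ t) (∑-const n (a ℤ.* a)) ⟩
    q ℤ.+ + n ℤ.* (a ℤ.* a)                    ∎

∑-*-∑ : ∀ m n f g → ∑ m f ℤ.* ∑ n g ≡ ∑ m (λ i → ∑ n (λ j → f i ℤ.* g j))
∑-*-∑ m n f g = begin
  ∑ m f ℤ.* ∑ n g                           ≡⟨ ℤ.*-comm (∑ m f) (∑ n g) ⟩
  ∑ n g ℤ.* ∑ m f                           ≡⟨ ∑-*ˡ m (∑ n g) f ⟩
  ∑ m (λ i → ∑ n g ℤ.* f i)                 ≡⟨ ∑-cong m (λ i → trans (ℤ.*-comm (∑ n g) (f i)) (∑-*ˡ n (f i) g)) ⟩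
  ∑ m (λ i → ∑ n (λ j → f i ℤ.* g j))       ∎
  where open ≡-Reasoning

-- Nonpositive terms are harmless, so only a single index can contribute. This converts uniqueness
-- of a solution into a bound on a counting sum.
∑-at-most-one : ∀ n {w c} → 0ℤ ℤ.≤ c → (∀ i → i ℕ.< n → w i ℤ.≤ c) →
  (∀ i j → i ℕ.< n → j ℕ.< n → 0ℤ ℤ.< w i → 0ℤ ℤ.< w j → i ≡ j) → ∑ n w ℤ.≤ c
∑-at-most-one zero            0≤c w≤c unique = 0≤c
∑-at-most-one (suc n) {w} {c} 0≤c w≤c unique with 0ℤ ℤ.<? w n
... | no  w≯0 = ℤ.≤-trans
  (ℤ.+-mono-≤ (∑-at-most-one n 0≤c (λ i i<n → w≤c i (ℕ.m≤n⇒m≤1+n i<n)) (λ i j i<n j<n → unique i j (ℕ.m≤n⇒m≤1+n i<n) (ℕ.m≤n⇒m≤1+n j<n))) (ℤ.≮⇒≥ w≯0))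
  (ℤ.≤-reflexive (ℤ.+-identityʳ c))
... | yes w>0 = ℤ.≤-trans (ℤ.+-mono-≤ {∑ n w} {0ℤ} others≤0 (w≤c n ℕ.≤-refl)) (ℤ.≤-reflexive (ℤ.+-identityˡ c))
  where
  others≤0 : ∑ n w ℤ.≤ 0ℤ
  others≤0 = ℤ.≤-trans
    (∑-mono n (λ i i<n → ℤ.≮⇒≥ (λ wᵢ>0 → ℕ.<⇒≢ i<n (unique i n (ℕ.m≤n⇒m≤1+n i<n) ℕ.≤-refl wᵢ>0 w>0))))
    (ℤ.≤-reflexive (trans (∑-const n 0ℤ) (ℤ.*-zeroʳ (+ n))))

∑-term : ∀ n {f} → (∀ i → 0ℤ ℤ.≤ f i) → ∀ {i} → i ℕ.< n → f i ℤ.≤ ∑ n f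
∑-term (suc n) {f} 0≤f {i} i<1+n with ℕ.m<1+n⇒m<n∨m≡n i<1+n
... | inj₁ i<n  = ℤ.≤-trans (∑-term n 0≤f i<n) (ℤ.i≤i+j (∑ n f) (f n) {{ℤ.nonNegative (0≤f n)}})
... | inj₂ refl = ℤ.i≤j+i (f n) (∑ n f) {{ℤ.nonNegative (∑-nonneg n 0≤f)}}

-- Periodic functions and their ℓ² norms

Periodic : ℕ → (ℕ → ℤ) → Set
Periodic W f = ∀ x → f (x + W) ≡ f x

periodic-translate : ∀ {W f} → Periodic W f → ∀ a → Periodic W (λ x → f (x + a))
periodic-translate {W} {f} per a x = trans (cong f (lemma x W a)) (per (x + a))
  where
  lemma : ∀ x W a → x + W + a ≡ x + a + W
  lemma = ℕ-Ring.solve-∀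

∑-rotate : ∀ {W f} → Periodic W f → ∀ a → ∑ W (λ x → f (x + a)) ≡ ∑ W f
∑-rotate {W} {f} per zero    = ∑-cong W (λ x → cong f (ℕ.+-identityʳ x))
∑-rotate {W} {f} per (suc a) = begin
  ∑ W (λ x → f (x + suc a))      ≡⟨ ∑-cong W (λ x → cong f (ℕ.+-suc x a)) ⟩
  ∑ W (λ x → g (suc x))          ≡⟨ cancel (g 0) _ ⟨
  g 0 ℤ.+ ∑ W (λ x → g (suc x)) ℤ.- g 0  ≡⟨ cong (ℤ._- g 0) (∑-suc W g) ⟨
  ∑ W g ℤ.+ g W ℤ.- g 0          ≡⟨ cong (λ t → ∑ W g ℤ.+ t ℤ.- g 0) (periodic-translate {W} {f} per a 0) ⟩
  ∑ W g ℤ.+ g 0 ℤ.- g 0          ≡⟨ cancel′ (∑ W g) (g 0) ⟩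
  ∑ W g                          ≡⟨ ∑-rotate per a ⟩
  ∑ W f                          ∎
  where
  open ≡-Reasoning
  g : ℕ → ℤ
  g x = f (x + a)
  cancel : ∀ i j → i ℤ.+ j ℤ.- i ≡ j
  cancel = solve-∀
  cancel′ : ∀ i j → i ℤ.+ j ℤ.- j ≡ i
  cancel′ = solve-∀

norm² : ℕ → (ℕ → ℤ) → ℤ
norm² W f = ∑ W (λ x → f x ℤ.* f x)

norm²-cong : ∀ W {f g} → (∀ x → f x ≡ g x) → norm² W f ≡ norm² W g
norm²-cong W f≗g = ∑-cong W (λ x → cong₂ ℤ._*_ (f≗g x) (f≗g x))

norm²-nonneg : ∀ W f → 0ℤ ℤ.≤ norm² W f
norm²-nonneg W f = ∑-nonneg W (λ x → 0≤i*i (f x))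

norm²-translate : ∀ {W f} → Periodic W f → ∀ a → norm² W (λ x → f (x + a)) ≡ norm² W f
norm²-translate {W} {f} per a = ∑-rotate {W} {λ x → f x ℤ.* f x} (λ x → cong₂ ℤ._*_ (per x) (per x)) a

norm²-*ˡ : ∀ W c f → norm² W (λ x → c ℤ.* f x) ≡ c ℤ.* c ℤ.* norm² W f
norm²-*ˡ W c f = trans (∑-cong W (λ x → lemma c (f x))) (sym (∑-*ˡ W (c ℤ.* c) (λ x → f x ℤ.* f x)))
  where
  lemma : ∀ c y → c ℤ.* y ℤ.* (c ℤ.* y) ≡ c ℤ.* c ℤ.* (y ℤ.* y)
  lemma = solve-∀

norm²-+ : ∀ W f g → norm² W (λ x → f x ℤ.+ g x) ℤ.≤ + 2 ℤ.* (norm² W f ℤ.+ norm² W g)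
norm²-+ W f g = begin
  norm² W (λ x → f x ℤ.+ g x)                             ≤⟨ ∑-mono W (λ x _ → pointwise (f x) (g x)) ⟩
  ∑ W (λ x → + 2 ℤ.* (f x ℤ.* f x ℤ.+ g x ℤ.* g x))       ≡⟨ ∑-*ˡ W (+ 2) _ ⟨
  + 2 ℤ.* ∑ W (λ x → f x ℤ.* f x ℤ.+ g x ℤ.* g x)         ≡⟨ cong (+ 2 ℤ.*_) (∑-+ W (λ x → f x ℤ.* f x) (λ x → g x ℤ.* g x)) ⟩
  + 2 ℤ.* (norm² W f ℤ.+ norm² W g)                       ∎
  where
  open ℤ.≤-Reasoning
  identity : ∀ a b → (a ℤ.+ b) ℤ.* (a ℤ.+ b) ℤ.+ (a ℤ.- b) ℤ.* (a ℤ.- b) ≡ + 2 ℤ.* (a ℤ.* a ℤ.+ b ℤ.* b)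
  identity = solve-∀
  pointwise : ∀ a b → (a ℤ.+ b) ℤ.* (a ℤ.+ b) ℤ.≤ + 2 ℤ.* (a ℤ.* a ℤ.+ b ℤ.* b)
  pointwise a b = ≤-add (0≤i*i (a ℤ.- b)) (identity a b)

norm²-- : ∀ W f g → norm² W (λ x → f x ℤ.- g x) ℤ.≤ + 2 ℤ.* (norm² W f ℤ.+ norm² W g)
norm²-- W f g = subst (λ t → norm² W (λ x → f x ℤ.- g x) ℤ.≤ + 2 ℤ.* (norm² W f ℤ.+ t))
  (∑-cong W (λ x → lemma (g x))) (norm²-+ W f (λ x → ℤ.- g x))
  where
  lemma : ∀ y → ℤ.- y ℤ.* ℤ.- y ≡ y ℤ.* y
  lemma = solve-∀

norm²-∑ : ∀ W n (a : ℕ → ℕ → ℤ) → norm² W (λ x → ∑ n (λ m → a m x)) ℤ.≤ + n ℤ.* ∑ n (λ m → norm² W (a m))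
norm²-∑ W n a = begin
  norm² W (λ x → ∑ n (λ m → a m x))                       ≤⟨ ∑-mono W (λ x _ → ∑-cauchy-schwarz n (λ m → a m x)) ⟩
  ∑ W (λ x → + n ℤ.* ∑ n (λ m → a m x ℤ.* a m x))         ≡⟨ ∑-*ˡ W (+ n) _ ⟨
  + n ℤ.* ∑ W (λ x → ∑ n (λ m → a m x ℤ.* a m x))         ≡⟨ cong (+ n ℤ.*_) (∑-swap W n (λ x m → a m x ℤ.* a m x)) ⟩
  + n ℤ.* ∑ n (λ m → norm² W (a m))                       ∎
  where open ℤ.≤-Reasoning

norm²-∑-≤ : ∀ W n (a : ℕ → ℕ → ℤ) {B} → (∀ m → m ℕ.< n → norm² W (a m) ℤ.≤ B) →
            norm² W (λ x → ∑ n (λ m → a m x)) ℤ.≤ + n ℤ.* (+ n ℤ.* B)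
norm²-∑-≤ W n a {B} a≤B = ℤ.≤-trans (norm²-∑ W n a)
  (*-monoˡ-≤-ℕ n (ℤ.≤-trans (∑-mono n a≤B) (ℤ.≤-reflexive (∑-const n B))))

norm²-∑-expand : ∀ W H (b : ℕ → ℕ → ℤ) →
  norm² W (λ x → ∑ H (λ t → b t x)) ≡ ∑ H (λ t → ∑ H (λ u → ∑ W (λ x → b t x ℤ.* b u x)))
norm²-∑-expand W H b = begin
  norm² W (λ x → ∑ H (λ t → b t x))                           ≡⟨ ∑-cong W (λ x → ∑-*-∑ H H (λ t → b t x) (λ t → b t x)) ⟩
  ∑ W (λ x → ∑ H (λ t → ∑ H (λ u → b t x ℤ.* b u x)))         ≡⟨ ∑-swap W H (λ x t → ∑ H (λ u → b t x ℤ.* b u x)) ⟩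
  ∑ H (λ t → ∑ W (λ x → ∑ H (λ u → b t x ℤ.* b u x)))         ≡⟨ ∑-cong H (λ t → ∑-swap W H (λ x u → b t x ℤ.* b u x)) ⟩
  ∑ H (λ t → ∑ H (λ u → ∑ W (λ x → b t x ℤ.* b u x)))         ∎
  where open ≡-Reasoning

-- The bound is independent of `M`, since only two blocks of `r` terms remain. The factor 4 is 2 for
-- the square of a difference times 2 for the two blocks.
norm²-window : ∀ W M r (a : ℕ → ℕ → ℤ) {B} → (∀ m → norm² W (a m) ℤ.≤ B) →
  norm² W (λ x → ∑ M (λ m → a m x) ℤ.- ∑ M (λ m → a (r + m) x)) ℤ.≤ + 4 ℤ.* (+ r ℤ.* (+ r ℤ.* B))
norm²-window W M r a {B} a≤B = begin
  norm² W (λ x → ∑ M (λ m → a m x) ℤ.- ∑ M (λ m → a (r + m) x))   ≡⟨ norm²-cong W (λ x → ∑-window M r (λ m → a m x)) ⟩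
  norm² W (λ x → ∑ r (λ m → a m x) ℤ.- ∑ r (λ m → a (M + m) x))
    ≤⟨ norm²-- W (λ x → ∑ r (λ m → a m x)) (λ x → ∑ r (λ m → a (M + m) x)) ⟩
  + 2 ℤ.* (norm² W (λ x → ∑ r (λ m → a m x)) ℤ.+ norm² W (λ x → ∑ r (λ m → a (M + m) x)))
    ≤⟨ *-monoˡ-≤-ℕ 2 (ℤ.+-mono-≤ (norm²-∑-≤ W r a (λ m _ → a≤B m)) (norm²-∑-≤ W r (λ m → a (M + m)) (λ m _ → a≤B (M + m)))) ⟩
  + 2 ℤ.* (+ r ℤ.* (+ r ℤ.* B) ℤ.+ + r ℤ.* (+ r ℤ.* B))            ≡⟨ lemma (+ r ℤ.* (+ r ℤ.* B)) ⟩
  + 4 ℤ.* (+ r ℤ.* (+ r ℤ.* B))                                    ∎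
  where
  open ℤ.≤-Reasoning
  lemma : ∀ y → + 2 ℤ.* (y ℤ.+ y) ≡ + 4 ℤ.* y
  lemma = solve-∀

-- Van der Corput's inequality

kronecker : ℕ → ℕ → ℤ
kronecker t u with t ℕ.≟ u
... | yes _ = 1ℤ
... | no  _ = 0ℤ

kronecker-refl : ∀ t → kronecker t t ≡ 1ℤ
kronecker-refl t with t ℕ.≟ t
... | yes _   = refl
... | no  t≢t = ⊥-elim (t≢t refl)

0≤kronecker : ∀ t u → 0ℤ ℤ.≤ kronecker t u
0≤kronecker t u with t ℕ.≟ u
... | yes _ = ℤ.+≤+ z≤n
... | no  _ = ℤ.≤-refl

kronecker-support : ∀ {t} i → 0ℤ ℤ.< kronecker t i → t ≡ i
kronecker-support {t} i p with t ℕ.≟ i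
... | yes t≡i = t≡i
kronecker-support {t} i (ℤ.+<+ ()) | no _

∑-kronecker : ∀ n t → ∑ n (kronecker t) ℤ.≤ 1ℤ
∑-kronecker n t = ∑-at-most-one n (ℤ.+≤+ z≤n) (λ i _ → kronecker≤1 i) (λ i j _ _ p q → trans (sym (kronecker-support i p)) (kronecker-support j q))
  where
  kronecker≤1 : ∀ i → kronecker t i ℤ.≤ 1ℤ
  kronecker≤1 i with t ℕ.≟ i
  ... | yes _ = ℤ.≤-refl
  ... | no  _ = ℤ.+≤+ z≤n

module VanDerCorput
  (W H′ R M : ℕ) (a : ℕ → ℕ → ℤ) {B Q : ℤ} (0≤Q : 0ℤ ℤ.≤ Q)
  (a≤B : ∀ m → norm² W (a m) ℤ.≤ B) where

  H : ℕ
  H = suc H′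

  correlation : ℕ → ℕ → ℤ
  correlation t u = ∑ M (λ m → ∑ W (λ x → a (t ℕ.* R + m) x ℤ.* a (u ℕ.* R + m) x))

  correlation-sym : ∀ t u → correlation t u ≡ correlation u t
  correlation-sym t u = ∑-cong M (λ m → ∑-cong W (λ x → ℤ.*-comm (a (t ℕ.* R + m) x) (a (u ℕ.* R + m) x)))

  0≤B : 0ℤ ℤ.≤ B
  0≤B = ℤ.≤-trans (norm²-nonneg W (a 0)) (a≤B 0)

  correlation-diag : ∀ t → correlation t t ℤ.≤ + M ℤ.* B
  correlation-diag t = ℤ.≤-trans (∑-mono M (λ m _ → a≤B (t ℕ.* R + m))) (ℤ.≤-reflexive (∑-const M B))

  module _ (corr : ∀ t u → t ℕ.< u → u ℕ.< H → + 2 ℤ.* + H ℤ.* correlation t u ℤ.≤ + M ℤ.* Q) where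

    open ℤ.≤-Reasoning

    D : ℤ
    D = + 2 ℤ.* + H ℤ.* (+ M ℤ.* B)

    0≤D : 0ℤ ℤ.≤ D
    0≤D = subst (0ℤ ℤ.≤_) (sym (ℤ.*-assoc (+ 2) (+ H) (+ M ℤ.* B))) (0≤n*i 2 (0≤n*i H (0≤n*i M 0≤B)))

    0≤D*kronecker : ∀ t u → 0ℤ ℤ.≤ D ℤ.* kronecker t u
    0≤D*kronecker t u = subst (ℤ._≤ D ℤ.* kronecker t u) (ℤ.*-zeroʳ D)
      (ℤ.*-monoˡ-≤-nonNeg D {{ℤ.nonNegative 0≤D}} (0≤kronecker t u))

    off-diagonal : ∀ t u → + M ℤ.* Q ℤ.≤ D ℤ.* kronecker t u ℤ.+ + M ℤ.* Q
    off-diagonal t u = ℤ.i≤j+i _ _ {{ℤ.nonNegative (0≤D*kronecker t u)}}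

    -- One formula for diagonal and off-diagonal entries: the Kronecker factor charges the large
    -- bound `D` only once in each row.
    correlation-≤ : ∀ t u → t ℕ.< H → u ℕ.< H →
      + 2 ℤ.* + H ℤ.* correlation t u ℤ.≤ D ℤ.* kronecker t u ℤ.+ + M ℤ.* Q
    correlation-≤ t u t<H u<H with ℕ.<-cmp t u
    ... | tri< t<u _ _ = ℤ.≤-trans (corr t u t<u u<H) (off-diagonal t u)
    ... | tri> _ _ u<t = ℤ.≤-trans (ℤ.≤-reflexive (cong (λ c → + 2 ℤ.* + H ℤ.* c) (correlation-sym t u))) (ℤ.≤-trans (corr u t u<t t<H) (off-diagonal t u))
    ... | tri≈ _ refl _ = begin
      + 2 ℤ.* + H ℤ.* correlation t t       ≡⟨ ℤ.*-assoc (+ 2) (+ H) _ ⟩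
      + 2 ℤ.* (+ H ℤ.* correlation t t)     ≤⟨ *-monoˡ-≤-ℕ 2 (*-monoˡ-≤-ℕ H (correlation-diag t)) ⟩
      + 2 ℤ.* (+ H ℤ.* (+ M ℤ.* B))         ≡⟨ ℤ.*-assoc (+ 2) (+ H) _ ⟨
      D                                     ≡⟨ ℤ.*-identityʳ D ⟨
      D ℤ.* 1ℤ                              ≡⟨ cong (D ℤ.*_) (kronecker-refl t) ⟨
      D ℤ.* kronecker t t                   ≤⟨ ℤ.i≤i+j _ _ {{ℤ.nonNegative (0≤n*i M 0≤Q)}} ⟩
      D ℤ.* kronecker t t ℤ.+ + M ℤ.* Q     ∎

    ∑∑-correlation : + 2 ℤ.* ∑ H (λ t → ∑ H (correlation t)) ℤ.≤ + H ℤ.* (+ M ℤ.* (+ 2 ℤ.* B ℤ.+ Q))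
    ∑∑-correlation = ℤ.*-cancelˡ-≤-pos _ _ (+ H) (begin
      + H ℤ.* (+ 2 ℤ.* ∑ H (λ t → ∑ H (correlation t)))
        ≡⟨ reassoc (+ H) (∑ H (λ t → ∑ H (correlation t))) ⟩
      + 2 ℤ.* + H ℤ.* ∑ H (λ t → ∑ H (correlation t))
        ≡⟨ ∑-*ˡ H (+ 2 ℤ.* + H) (λ t → ∑ H (correlation t)) ⟩
      ∑ H (λ t → + 2 ℤ.* + H ℤ.* ∑ H (correlation t))
        ≤⟨ ∑-mono H row ⟩
      ∑ H (λ _ → D ℤ.+ + H ℤ.* (+ M ℤ.* Q))
        ≡⟨ ∑-const H _ ⟩
      + H ℤ.* (D ℤ.+ + H ℤ.* (+ M ℤ.* Q))
        ≡⟨ collect (+ H) (+ M) B Q ⟩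
      + H ℤ.* (+ H ℤ.* (+ M ℤ.* (+ 2 ℤ.* B ℤ.+ Q))) ∎)
      where
      reassoc : ∀ h s → h ℤ.* (+ 2 ℤ.* s) ≡ + 2 ℤ.* h ℤ.* s
      reassoc = solve-∀
      collect : ∀ h m b q → h ℤ.* (+ 2 ℤ.* h ℤ.* (m ℤ.* b) ℤ.+ h ℤ.* (m ℤ.* q)) ≡ h ℤ.* (h ℤ.* (m ℤ.* (+ 2 ℤ.* b ℤ.+ q)))
      collect = solve-∀
      row : ∀ t → t ℕ.< H → + 2 ℤ.* + H ℤ.* ∑ H (correlation t) ℤ.≤ D ℤ.+ + H ℤ.* (+ M ℤ.* Q)
      row t t<H = begin
        + 2 ℤ.* + H ℤ.* ∑ H (correlation t)                      ≡⟨ ∑-*ˡ H (+ 2 ℤ.* + H) (correlation t) ⟩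
        ∑ H (λ u → + 2 ℤ.* + H ℤ.* correlation t u)              ≤⟨ ∑-mono H (λ u u<H → correlation-≤ t u t<H u<H) ⟩
        ∑ H (λ u → D ℤ.* kronecker t u ℤ.+ + M ℤ.* Q)            ≡⟨ ∑-+ H _ _ ⟩
        ∑ H (λ u → D ℤ.* kronecker t u) ℤ.+ ∑ H (λ _ → + M ℤ.* Q) ≡⟨ cong₂ ℤ._+_ (sym (∑-*ˡ H D (kronecker t))) (∑-const H (+ M ℤ.* Q)) ⟩
        D ℤ.* ∑ H (kronecker t) ℤ.+ + H ℤ.* (+ M ℤ.* Q)          ≤⟨ ℤ.+-monoˡ-≤ _ (ℤ.*-monoˡ-≤-nonNeg D {{ℤ.nonNegative 0≤D}} (∑-kronecker H t)) ⟩
        D ℤ.* 1ℤ ℤ.+ + H ℤ.* (+ M ℤ.* Q)                         ≡⟨ cong (ℤ._+ + H ℤ.* (+ M ℤ.* Q)) (ℤ.*-identityʳ D) ⟩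
        D ℤ.+ + H ℤ.* (+ M ℤ.* Q)                                ∎

    shifted error : ℕ → ℕ → ℤ
    shifted t x = ∑ M (λ m → a (t ℕ.* R + m) x)
    error   t x = ∑ M (λ m → a m x) ℤ.- shifted t x

    norm²-main : + 2 ℤ.* norm² W (λ x → ∑ H (λ t → shifted t x)) ℤ.≤ + M ℤ.* (+ H ℤ.* (+ M ℤ.* (+ 2 ℤ.* B ℤ.+ Q)))
    norm²-main = begin
      + 2 ℤ.* norm² W (λ x → ∑ H (λ t → shifted t x))
        ≡⟨ cong (+ 2 ℤ.*_) (norm²-cong W (λ x → ∑-swap H M (λ t m → a (t ℕ.* R + m) x))) ⟩
      + 2 ℤ.* norm² W (λ x → ∑ M (λ m → ∑ H (λ t → a (t ℕ.* R + m) x)))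
        ≤⟨ *-monoˡ-≤-ℕ 2 (norm²-∑ W M (λ m x → ∑ H (λ t → a (t ℕ.* R + m) x))) ⟩
      + 2 ℤ.* (+ M ℤ.* ∑ M (λ m → norm² W (λ x → ∑ H (λ t → a (t ℕ.* R + m) x))))
        ≡⟨ cong (λ s → + 2 ℤ.* (+ M ℤ.* s)) (∑-cong M (λ m → norm²-∑-expand W H (λ t → a (t ℕ.* R + m)))) ⟩
      + 2 ℤ.* (+ M ℤ.* ∑ M (λ m → ∑ H (λ t → ∑ H (λ u → ip m t u))))
        ≡⟨ cong (λ s → + 2 ℤ.* (+ M ℤ.* s)) (trans (∑-swap M H (λ m t → ∑ H (ip m t))) (∑-cong H (λ t → ∑-swap M H (λ m u → ip m t u)))) ⟩
      + 2 ℤ.* (+ M ℤ.* ∑ H (λ t → ∑ H (correlation t)))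
        ≡⟨ exchange (+ M) _ ⟩
      + M ℤ.* (+ 2 ℤ.* ∑ H (λ t → ∑ H (correlation t)))
        ≤⟨ *-monoˡ-≤-ℕ M ∑∑-correlation ⟩
      + M ℤ.* (+ H ℤ.* (+ M ℤ.* (+ 2 ℤ.* B ℤ.+ Q))) ∎
      where
      ip : ℕ → ℕ → ℕ → ℤ
      ip m t u = ∑ W (λ x → a (t ℕ.* R + m) x ℤ.* a (u ℕ.* R + m) x)
      exchange : ∀ m s → + 2 ℤ.* (m ℤ.* s) ≡ m ℤ.* (+ 2 ℤ.* s)
      exchange = solve-∀

    L : ℤ
    L = + (H ℕ.* R)

    norm²-error : norm² W (λ x → ∑ H (λ t → error t x)) ℤ.≤ + H ℤ.* (+ H ℤ.* (+ 4 ℤ.* (L ℤ.* (L ℤ.* B))))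
    norm²-error = norm²-∑-≤ W H error (λ t t<H → ℤ.≤-trans (norm²-window W M (t ℕ.* R) a a≤B)
      (*-monoˡ-≤-ℕ 4 (widen (ℕ.*-monoˡ-≤ R (ℕ.<⇒≤ t<H)))))
      where
      widen : ∀ {r l} → r ℕ.≤ l → + r ℤ.* (+ r ℤ.* B) ℤ.≤ + l ℤ.* (+ l ℤ.* B)
      widen {r} {l} r≤l = ℤ.≤-trans (*-monoˡ-≤-ℕ r step) (ℤ.*-monoʳ-≤-nonNeg (+ l ℤ.* B) {{ℤ.nonNegative (0≤n*i l 0≤B)}} (ℤ.+≤+ r≤l))
        where
        step : + r ℤ.* B ℤ.≤ + l ℤ.* B
        step = ℤ.*-monoʳ-≤-nonNeg B {{ℤ.nonNegative 0≤B}} (ℤ.+≤+ r≤l)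

    -- The sum over one window is compared with those over the `H` windows displaced by `t R`, at
    -- the cost of at most `L = H R` terms at each end. Cauchy-Schwarz over `m` leaves the
    -- correlations at displacements `(u - t) R`. The factor `2 H` in `corr` is the right scale:
    -- about `H²` off-diagonal entries then weigh no more than `H` diagonal ones.
    van-der-corput : + H ℤ.* norm² W (λ x → ∑ M (λ m → a m x)) ℤ.≤
      + M ℤ.* (+ M ℤ.* (+ 2 ℤ.* B ℤ.+ Q)) ℤ.+ + 8 ℤ.* (+ H ℤ.* (L ℤ.* (L ℤ.* B)))
    van-der-corput = ℤ.*-cancelˡ-≤-pos _ _ (+ H) (begin
      + H ℤ.* (+ H ℤ.* norm² W S)                                   ≡⟨ ℤ.*-assoc (+ H) (+ H) _ ⟨
      + H ℤ.* + H ℤ.* norm² W S                                     ≡⟨ norm²-*ˡ W (+ H) S ⟨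
      norm² W (λ x → + H ℤ.* S x)                                   ≡⟨ norm²-cong W decompose ⟩
      norm² W (λ x → ∑ H (λ t → shifted t x) ℤ.+ ∑ H (λ t → error t x))
        ≤⟨ norm²-+ W main (λ x → ∑ H (λ t → error t x)) ⟩
      + 2 ℤ.* (norm² W main ℤ.+ norm² W (λ x → ∑ H (λ t → error t x)))   ≡⟨ ℤ.*-distribˡ-+ (+ 2) (norm² W main) _ ⟩
      + 2 ℤ.* norm² W main ℤ.+ + 2 ℤ.* norm² W (λ x → ∑ H (λ t → error t x))
        ≤⟨ ℤ.+-mono-≤ norm²-main (*-monoˡ-≤-ℕ 2 norm²-error) ⟩
      + M ℤ.* (+ H ℤ.* (+ M ℤ.* (+ 2 ℤ.* B ℤ.+ Q))) ℤ.+ + 2 ℤ.* (+ H ℤ.* (+ H ℤ.* (+ 4 ℤ.* (L ℤ.* (L ℤ.* B)))))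
        ≡⟨ collect (+ M) (+ H) (+ 2 ℤ.* B ℤ.+ Q) (L ℤ.* (L ℤ.* B)) ⟩
      + H ℤ.* (+ M ℤ.* (+ M ℤ.* (+ 2 ℤ.* B ℤ.+ Q)) ℤ.+ + 8 ℤ.* (+ H ℤ.* (L ℤ.* (L ℤ.* B)))) ∎)
      where
      S main : ℕ → ℤ
      S x = ∑ M (λ m → a m x)
      main x = ∑ H (λ t → shifted t x)
      collect : ∀ m h y z → m ℤ.* (h ℤ.* (m ℤ.* y)) ℤ.+ + 2 ℤ.* (h ℤ.* (h ℤ.* (+ 4 ℤ.* z))) ≡ h ℤ.* (m ℤ.* (m ℤ.* y) ℤ.+ + 8 ℤ.* (h ℤ.* z))
      collect = solve-∀
      complete : ∀ s y → y ℤ.+ (s ℤ.- y) ≡ s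
      complete = solve-∀
      decompose : ∀ x → + H ℤ.* S x ≡ main x ℤ.+ ∑ H (λ t → error t x)
      decompose x = trans (sym (∑-const H (S x))) (trans (∑-cong H (λ t → sym (complete (S x) (shifted t x)))) (∑-+ H (λ t → shifted t x) (λ t → error t x)))

-- Almost invariance of polynomial averages

-- s is an integer-valued polynomial of degree at most k with k-th coefficient
-- μ / k!, whose iterated differences are natural numbers.
HasLeading : ℕ → ℕ → (ℕ → ℕ) → Set
HasLeading zero    μ s = ∀ m → s m ≡ μ
HasLeading (suc k) μ s = ∀ h → ∃[ δ ] (HasLeading k (h ℕ.* μ) δ × (∀ m → s (m + h) ≡ s m + δ m))

hasLeading-shift : ∀ k {μ s} → HasLeading k μ s → ∀ t → HasLeading k μ (λ m → s (t + m))
hasLeading-shift zero    lead t m = lead (t + m)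
hasLeading-shift (suc k) {s = s} lead t h with lead h
... | δ , leadδ , eq = (λ m → δ (t + m)) , hasLeading-shift k leadδ t ,
  λ m → trans (cong s (sym (ℕ.+-assoc t m h))) (eq (t + m))

orbitSum : (ℕ → ℕ) → ℕ → (ℕ → ℤ) → ℕ → ℤ
orbitSum s M f x = ∑ M (λ m → f (x + s m))

difference : ℕ → (ℕ → ℤ) → ℕ → ℤ
difference a f x = f x ℤ.- f (x + a)

periodic-difference : ∀ {W f} → Periodic W f → ∀ a → Periodic W (difference a f)
periodic-difference per a x = cong₂ ℤ._-_ (per x) (periodic-translate per a x)

norm²-difference : ∀ {W f} → Periodic W f → ∀ a → norm² W (difference a f) ℤ.≤ + 4 ℤ.* norm² W f
norm²-difference {W} {f} per a = begin
  norm² W (difference a f)                                 ≤⟨ norm²-- W f (λ x → f (x + a)) ⟩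
  + 2 ℤ.* (norm² W f ℤ.+ norm² W (λ x → f (x + a)))        ≡⟨ cong (λ t → + 2 ℤ.* (norm² W f ℤ.+ t)) (norm²-translate per a) ⟩
  + 2 ℤ.* (norm² W f ℤ.+ norm² W f)                        ≡⟨ lemma (norm² W f) ⟩
  + 4 ℤ.* norm² W f                                        ∎
  where
  open ℤ.≤-Reasoning
  lemma : ∀ y → + 2 ℤ.* (y ℤ.+ y) ≡ + 4 ℤ.* y
  lemma = solve-∀

-- Sum of `(M f - H g)² ≥ 0` over a period. The weights suit a `g` whose norm is at most about
-- `M / H` times that of `f`, and no square roots of norms appear.
∑-young : ∀ W M H f g →
  M ℤ.* (+ 2 ℤ.* H ℤ.* ∑ W (λ x → f x ℤ.* g x)) ℤ.≤ M ℤ.* (M ℤ.* norm² W f) ℤ.+ H ℤ.* H ℤ.* norm² W g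
∑-young W M H f g = begin
  M ℤ.* (+ 2 ℤ.* H ℤ.* ∑ W (λ x → f x ℤ.* g x))
    ≡⟨ trans (sym (ℤ.*-assoc M (+ 2 ℤ.* H) _)) (∑-*ˡ W (M ℤ.* (+ 2 ℤ.* H)) (λ x → f x ℤ.* g x)) ⟩
  ∑ W (λ x → M ℤ.* (+ 2 ℤ.* H) ℤ.* (f x ℤ.* g x))
    ≤⟨ ∑-mono W (λ x _ → pointwise M H (f x) (g x)) ⟩
  ∑ W (λ x → M ℤ.* M ℤ.* (f x ℤ.* f x) ℤ.+ H ℤ.* H ℤ.* (g x ℤ.* g x))
    ≡⟨ ∑-+ W (λ x → M ℤ.* M ℤ.* (f x ℤ.* f x)) (λ x → H ℤ.* H ℤ.* (g x ℤ.* g x)) ⟩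
  ∑ W (λ x → M ℤ.* M ℤ.* (f x ℤ.* f x)) ℤ.+ ∑ W (λ x → H ℤ.* H ℤ.* (g x ℤ.* g x))
    ≡⟨ cong₂ ℤ._+_ (∑-*ˡ W (M ℤ.* M) (λ x → f x ℤ.* f x)) (∑-*ˡ W (H ℤ.* H) (λ x → g x ℤ.* g x)) ⟨
  M ℤ.* M ℤ.* norm² W f ℤ.+ H ℤ.* H ℤ.* norm² W g
    ≡⟨ cong (ℤ._+ H ℤ.* H ℤ.* norm² W g) (ℤ.*-assoc M M (norm² W f)) ⟩
  M ℤ.* (M ℤ.* norm² W f) ℤ.+ H ℤ.* H ℤ.* norm² W g ∎
  where
  open ℤ.≤-Reasoning
  identity : ∀ m h a b → m ℤ.* (+ 2 ℤ.* h) ℤ.* (a ℤ.* b) ℤ.+ (m ℤ.* a ℤ.- h ℤ.* b) ℤ.* (m ℤ.* a ℤ.- h ℤ.* b) ≡ m ℤ.* m ℤ.* (a ℤ.* a) ℤ.+ h ℤ.* h ℤ.* (b ℤ.* b)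
  identity = solve-∀
  pointwise : ∀ m h a b → m ℤ.* (+ 2 ℤ.* h) ℤ.* (a ℤ.* b) ℤ.≤ m ℤ.* m ℤ.* (a ℤ.* a) ℤ.+ h ℤ.* h ℤ.* (b ℤ.* b)
  pointwise m h a b = ≤-add (0≤i*i (m ℤ.* a ℤ.- h ℤ.* b)) (identity m h a b)

-- Averages along a polynomial of degree k + 1 hardly change under translation
-- by multiples of D μ, up to the length scale of the polynomial itself.
AlmostInvariant : (k κ D c : ℕ) → Set
AlmostInvariant k κ D c = ∀ {W f} → Periodic W f → ∀ {μ s} → HasLeading (suc k) μ s →
  ∀ M r → c ℕ.* r ℕ.≤ suc M ℕ.^ suc k →
  + κ ℤ.* norm² W (orbitSum s (suc M) (difference (D ℕ.* μ ℕ.* r) f)) ℤ.≤ + suc M ℤ.* (+ suc M ℤ.* norm² W f)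

-- Along a linear sequence, translating `f` by `μ r` is displacing `m` by `r`, so the difference
-- reduces to boundary blocks. Their contribution `4 κ r²` is at most `(4 κ r)² ≤ M²`.
almostInvariant-linear : ∀ κ → AlmostInvariant 0 κ 1 (4 ℕ.* κ)
almostInvariant-linear κ {W} {f} per {μ} {s} lead M′ r cr≤M = begin
  + κ ℤ.* norm² W (orbitSum s M (difference (1 ℕ.* μ ℕ.* r) f))
    ≡⟨ cong (+ κ ℤ.*_) (norm²-cong W window) ⟩
  + κ ℤ.* norm² W (λ x → ∑ M (λ m → a m x) ℤ.- ∑ M (λ m → a (r + m) x))
    ≤⟨ *-monoˡ-≤-ℕ κ (norm²-window W M r a (λ m → ℤ.≤-reflexive (norm²-translate per (s m)))) ⟩
  + κ ℤ.* (+ 4 ℤ.* (+ r ℤ.* (+ r ℤ.* F)))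
    ≡⟨ regroup (+ κ) (+ r) F ⟩
  + 4 ℤ.* + κ ℤ.* + r ℤ.* + r ℤ.* F
    ≡⟨ cong (ℤ._* F) (trans (ℤ.pos-* (4 ℕ.* κ ℕ.* r) r) (trans (cong (ℤ._* + r) (ℤ.pos-* (4 ℕ.* κ) r)) (cong (λ t → t ℤ.* + r ℤ.* + r) (ℤ.pos-* 4 κ)))) ⟨
  + (4 ℕ.* κ ℕ.* r ℕ.* r) ℤ.* F
    ≤⟨ ℤ.*-monoʳ-≤-nonNeg F {{ℤ.nonNegative (norm²-nonneg W f)}} (ℤ.+≤+ square) ⟩
  + (M ℕ.* M) ℤ.* F
    ≡⟨ trans (cong (ℤ._* F) (ℤ.pos-* M M)) (ℤ.*-assoc (+ M) (+ M) F) ⟩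
  + M ℤ.* (+ M ℤ.* F) ∎
  where
  open ℤ.≤-Reasoning
  M = suc M′
  F = norm² W f
  a : ℕ → ℕ → ℤ
  a m x = f (x + s m)
  regroup : ∀ k r y → k ℤ.* (+ 4 ℤ.* (r ℤ.* (r ℤ.* y))) ≡ + 4 ℤ.* k ℤ.* r ℤ.* r ℤ.* y
  regroup = solve-∀
  step : ∀ m → s m + 1 ℕ.* μ ℕ.* r ≡ s (r + m)
  step m with lead r
  ... | δ , leadδ , eq = trans (cong (s m ℕ.+_) (trans (commute μ r) (sym (leadδ m)))) (trans (sym (eq m)) (cong s (ℕ.+-comm m r)))
    where
    commute : ∀ μ r → 1 ℕ.* μ ℕ.* r ≡ r ℕ.* μ
    commute = ℕ-Ring.solve-∀
  window : ∀ x → orbitSum s M (difference (1 ℕ.* μ ℕ.* r) f) x ≡ ∑ M (λ m → a m x) ℤ.- ∑ M (λ m → a (r + m) x)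
  window x = trans
    (∑-cong M (λ m → cong (λ y → a m x ℤ.- f y) (trans (ℕ.+-assoc x (s m) _) (cong (x ℕ.+_) (step m)))))
    (∑-- M (λ m → a m x) (λ m → a (r + m) x))
  r≤r² : ∀ κ r → 4 ℕ.* κ ℕ.* r ℕ.* r ℕ.≤ (4 ℕ.* κ ℕ.* r) ℕ.* (4 ℕ.* κ ℕ.* r)
  r≤r² zero    r = z≤n
  r≤r² (suc κ) r = ℕ.*-monoʳ-≤ (4 ℕ.* suc κ ℕ.* r) (ℕ.m≤n*m r (4 ℕ.* suc κ))
  square : 4 ℕ.* κ ℕ.* r ℕ.* r ℕ.≤ M ℕ.* M
  square = ℕ.≤-trans (r≤r² κ r) (ℕ.*-mono-≤ cr≤M′ cr≤M′)
    where
    cr≤M′ : 4 ℕ.* κ ℕ.* r ℕ.≤ M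
    cr≤M′ = ℕ.≤-trans cr≤M (ℕ.≤-reflexive (ℕ.*-identityʳ M))

∣-factorial : ∀ {h n} → 1 ℕ.≤ h → h ℕ.≤ n → h ∣ℕ n !
∣-factorial {suc h} _ h≤n = ℕ∣.∣-trans (ℕ∣.m∣m*n (h !)) (ℕ∣.m≤n⇒m!∣n! h≤n)

module Differencing
  (k H′ D′ c′ : ℕ) (invariant : AlmostInvariant k (suc H′ ℕ.* suc H′) D′ c′)
  {W : ℕ} {f : ℕ → ℤ} (per : Periodic W f) {μ : ℕ} {s : ℕ → ℕ} (lead : HasLeading (suc (suc k)) μ s)
  (M′ R r : ℕ)
  (R-small : 6 ℕ.* suc H′ ℕ.* (suc H′ ℕ.* R) ℕ.≤ suc M′)
  (r-small : c′ ℕ.* (suc H′ ! ℕ.* r) ℕ.≤ suc M′ ℕ.^ suc k) where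

  open ℤ.≤-Reasoning

  H M : ℕ
  H = suc H′
  M = suc M′

  -- The translation contains `R` because displacing `m` by `h R` produces the leading coefficient
  -- `h R μ`, and `H !` so that one translation serves all `h ≤ H`.
  g : ℕ → ℤ
  g = difference (D′ ℕ.* H ! ℕ.* μ ℕ.* (R ℕ.* r)) f

  g-periodic : Periodic W g
  g-periodic = periodic-difference per _

  F : ℤ
  F = norm² W f

  0≤F : 0ℤ ℤ.≤ F
  0≤F = norm²-nonneg W f

  a : ℕ → ℕ → ℤ
  a m x = g (x + s m)

  a-bound : ∀ m → norm² W (a m) ℤ.≤ + 4 ℤ.* F
  a-bound m = ℤ.≤-trans (ℤ.≤-reflexive (norm²-translate g-periodic (s m))) (norm²-difference per _)

  open VanDerCorput W H′ R M a (0≤n*i 5 0≤F) a-bound using (correlation; van-der-corput)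

  -- Removing the common translation by `s (t R + m)` leaves the inner product of `g` with its sum
  -- `V` along the difference sequence `δ′`, of degree one less and leading coefficient `h R μ`.
  -- With `q = H ! / h` the translation in `g` is `D′ (h R μ) (q r)`, so `invariant` bounds `V`. The
  -- 5 is 4 from the norm of `g` plus 1 from `V`.
  correlation-bound : ∀ t h → 1 ℕ.≤ h → h ℕ.≤ H →
    + 2 ℤ.* + H ℤ.* correlation t (t + h) ℤ.≤ + M ℤ.* (+ 5 ℤ.* F)
  correlation-bound t h 1≤h h≤H with lead (h ℕ.* R) | ∣-factorial 1≤h h≤H
  ... | δ , leadδ , eq | ℕ∣.divides q H!≡qh = ℤ.*-cancelˡ-≤-pos _ _ (+ M) (begin
    + M ℤ.* (+ 2 ℤ.* + H ℤ.* correlation t (t + h))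
      ≡⟨ cong (λ y → + M ℤ.* (+ 2 ℤ.* + H ℤ.* y)) correlation≡ ⟩
    + M ℤ.* (+ 2 ℤ.* + H ℤ.* ∑ W (λ x → g x ℤ.* V x))
      ≤⟨ ∑-young W (+ M) (+ H) g V ⟩
    + M ℤ.* (+ M ℤ.* norm² W g) ℤ.+ + H ℤ.* + H ℤ.* norm² W V
      ≤⟨ ℤ.+-mono-≤ (*-monoˡ-≤-ℕ M (*-monoˡ-≤-ℕ M (norm²-difference per _))) V-bound ⟩
    + M ℤ.* (+ M ℤ.* (+ 4 ℤ.* F)) ℤ.+ + M ℤ.* (+ M ℤ.* F)
      ≡⟨ collect (+ M) F ⟩
    + M ℤ.* (+ M ℤ.* (+ 5 ℤ.* F)) ∎)
    where
    collect : ∀ m y → m ℤ.* (m ℤ.* (+ 4 ℤ.* y)) ℤ.+ m ℤ.* (m ℤ.* y) ≡ m ℤ.* (m ℤ.* (+ 5 ℤ.* y))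
    collect = solve-∀
    δ′ : ℕ → ℕ
    δ′ m = δ (t ℕ.* R + m)
    V : ℕ → ℤ
    V = orbitSum δ′ M g
    s-step : ∀ m → s ((t + h) ℕ.* R + m) ≡ δ′ m + s (t ℕ.* R + m)
    s-step m = trans (cong s (regroup t h R m)) (trans (eq (t ℕ.* R + m)) (ℕ.+-comm (s (t ℕ.* R + m)) (δ′ m)))
      where
      regroup : ∀ t h R m → (t + h) ℕ.* R + m ≡ t ℕ.* R + m + h ℕ.* R
      regroup = ℕ-Ring.solve-∀
    inner : ∀ m → ∑ W (λ x → a (t ℕ.* R + m) x ℤ.* a ((t + h) ℕ.* R + m) x) ≡ ∑ W (λ x → g x ℤ.* g (x + δ′ m))
    inner m = trans
      (∑-cong W (λ x → cong (λ y → a (t ℕ.* R + m) x ℤ.* g y) (trans (cong (x ℕ.+_) (s-step m)) (swap x (δ′ m) (s (t ℕ.* R + m))))))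
      (∑-rotate {W} {λ x → g x ℤ.* g (x + δ′ m)} (λ x → cong₂ ℤ._*_ (g-periodic x) (periodic-translate g-periodic (δ′ m) x)) (s (t ℕ.* R + m)))
      where
      swap : ∀ x d y → x + (d + y) ≡ x + y + d
      swap = ℕ-Ring.solve-∀
    correlation≡ : correlation t (t + h) ≡ ∑ W (λ x → g x ℤ.* V x)
    correlation≡ = trans (∑-cong M inner) (trans (sym (∑-swap W M (λ x m → g x ℤ.* g (x + δ′ m))))
      (∑-cong W (λ x → sym (∑-*ˡ M (g x) (λ m → g (x + δ′ m))))))
    shift≡ : D′ ℕ.* (h ℕ.* R ℕ.* μ) ℕ.* (q ℕ.* r) ≡ D′ ℕ.* H ! ℕ.* μ ℕ.* (R ℕ.* r)
    shift≡ = trans (regroup D′ h R μ q r) (cong (λ y → D′ ℕ.* y ℕ.* μ ℕ.* (R ℕ.* r)) (sym H!≡qh))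
      where
      regroup : ∀ D h R μ q r → D ℕ.* (h ℕ.* R ℕ.* μ) ℕ.* (q ℕ.* r) ≡ D ℕ.* (q ℕ.* h) ℕ.* μ ℕ.* (R ℕ.* r)
      regroup = ℕ-Ring.solve-∀
    q≤H! : q ℕ.≤ H !
    q≤H! = ℕ.≤-trans (ℕ.m≤m*n q h {{ℕ.>-nonZero 1≤h}}) (ℕ.≤-reflexive (sym H!≡qh))
    V-bound : + H ℤ.* + H ℤ.* norm² W V ℤ.≤ + M ℤ.* (+ M ℤ.* F)
    V-bound = subst₂ (λ z d → z ℤ.* norm² W (orbitSum δ′ M (difference d f)) ℤ.≤ + M ℤ.* (+ M ℤ.* F))
      (ℤ.pos-* H H) shift≡
      (invariant per (hasLeading-shift (suc k) leadδ (t ℕ.* R)) M′ (q ℕ.* r)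
        (ℕ.≤-trans (ℕ.*-monoʳ-≤ c′ (ℕ.*-monoˡ-≤ r q≤H!)) r-small))

  -- With `B = 4 F` and `Q = 5 F` the main term has the factor `2 · 4 + 5 = 13`, and `R-small` makes
  -- the boundary error at most one further `M² F`.
  orbitSum-bound : + H ℤ.* norm² W (orbitSum s M g) ℤ.≤ + 14 ℤ.* (+ M ℤ.* (+ M ℤ.* F))
  orbitSum-bound = begin
    + H ℤ.* norm² W (orbitSum s M g)
      ≤⟨ van-der-corput correlations ⟩
    + M ℤ.* (+ M ℤ.* (+ 2 ℤ.* (+ 4 ℤ.* F) ℤ.+ + 5 ℤ.* F)) ℤ.+ + 8 ℤ.* (+ H ℤ.* (+ L ℤ.* (+ L ℤ.* (+ 4 ℤ.* F))))
      ≡⟨ regroup (+ M) (+ H) (+ L) F ⟩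
    + 13 ℤ.* (+ M ℤ.* (+ M ℤ.* F)) ℤ.+ + 32 ℤ.* (+ H ℤ.* (+ L ℤ.* + L)) ℤ.* F
      ≡⟨ cong (λ y → + 13 ℤ.* (+ M ℤ.* (+ M ℤ.* F)) ℤ.+ y ℤ.* F) cast ⟨
    + 13 ℤ.* (+ M ℤ.* (+ M ℤ.* F)) ℤ.+ + (32 ℕ.* (H ℕ.* (L ℕ.* L))) ℤ.* F
      ≤⟨ ℤ.+-monoʳ-≤ (+ 13 ℤ.* (+ M ℤ.* (+ M ℤ.* F))) (ℤ.*-monoʳ-≤-nonNeg F {{ℤ.nonNegative 0≤F}} (ℤ.+≤+ error-small)) ⟩
    + 13 ℤ.* (+ M ℤ.* (+ M ℤ.* F)) ℤ.+ + (M ℕ.* M) ℤ.* F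
      ≡⟨ trans (cong (λ y → + 13 ℤ.* (+ M ℤ.* (+ M ℤ.* F)) ℤ.+ y ℤ.* F) (ℤ.pos-* M M)) (collect (+ M) F) ⟩
    + 14 ℤ.* (+ M ℤ.* (+ M ℤ.* F)) ∎
    where
    L : ℕ
    L = H ℕ.* R
    regroup : ∀ m h l y → m ℤ.* (m ℤ.* (+ 2 ℤ.* (+ 4 ℤ.* y) ℤ.+ + 5 ℤ.* y)) ℤ.+ + 8 ℤ.* (h ℤ.* (l ℤ.* (l ℤ.* (+ 4 ℤ.* y)))) ≡ + 13 ℤ.* (m ℤ.* (m ℤ.* y)) ℤ.+ + 32 ℤ.* (h ℤ.* (l ℤ.* l)) ℤ.* y
    regroup = solve-∀
    collect : ∀ m y → + 13 ℤ.* (m ℤ.* (m ℤ.* y)) ℤ.+ m ℤ.* m ℤ.* y ≡ + 14 ℤ.* (m ℤ.* (m ℤ.* y))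
    collect = solve-∀
    cast : + (32 ℕ.* (H ℕ.* (L ℕ.* L))) ≡ + 32 ℤ.* (+ H ℤ.* (+ L ℤ.* + L))
    cast = trans (ℤ.pos-* 32 (H ℕ.* (L ℕ.* L))) (cong (+ 32 ℤ.*_) (trans (ℤ.pos-* H (L ℕ.* L)) (cong (+ H ℤ.*_) (ℤ.pos-* L L))))
    error-small : 32 ℕ.* (H ℕ.* (L ℕ.* L)) ℕ.≤ M ℕ.* M
    error-small = ℕR.begin
      32 ℕ.* (H ℕ.* (L ℕ.* L))              ℕR.≤⟨ ℕ.*-mono-≤ (ℕ.m≤m+n 32 4) (ℕ.*-monoˡ-≤ (L ℕ.* L) (ℕ.m≤m*n H H)) ⟩
      36 ℕ.* (H ℕ.* H ℕ.* (L ℕ.* L))        ℕR.≡⟨ square H L ⟩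
      (6 ℕ.* H ℕ.* L) ℕ.* (6 ℕ.* H ℕ.* L)   ℕR.≤⟨ ℕ.*-mono-≤ R-small R-small ⟩
      M ℕ.* M                               ℕR.∎
      where
      module ℕR = ℕ.≤-Reasoning
      square : ∀ h l → 36 ℕ.* (h ℕ.* h ℕ.* (l ℕ.* l)) ≡ (6 ℕ.* h ℕ.* l) ℕ.* (6 ℕ.* h ℕ.* l)
      square = ℕ-Ring.solve-∀
    correlations : ∀ t u → t ℕ.< u → u ℕ.< H → + 2 ℤ.* + H ℤ.* correlation t u ℤ.≤ + M ℤ.* (+ 5 ℤ.* F)
    correlations t u t<u u<H = subst (λ u → + 2 ℤ.* + H ℤ.* correlation t u ℤ.≤ + M ℤ.* (+ 5 ℤ.* F))
      (ℕ.m+[n∸m]≡n (ℕ.<⇒≤ t<u))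
      (correlation-bound t (u ℕ.∸ t) (ℕ.m<n⇒0<n∸m t<u) (ℕ.≤-trans (ℕ.m∸n≤m u t) (ℕ.<⇒≤ u<H)))

-- The error terms of the differencing step are negligible only for short
-- translations R r with R ≤ M / C and r ≤ M ^ (k + 1) / C; sums of two such
-- translations exhaust the range up to M ^ (k + 2) / c.
two-scale : ∀ k C M j → .{{_ : NonZero C}} → .{{_ : NonZero M}} →
  2 ℕ.* C ℕ.* C ℕ.* C ℕ.^ suc (suc k) ℕ.* j ℕ.≤ M ℕ.^ suc (suc k) →
  ∃[ R₁ ] ∃[ r₁ ] ∃[ R₂ ] ∃[ r₂ ]
    (R₁ ℕ.* r₁ + R₂ ℕ.* r₂ ≡ j × C ℕ.* R₁ ℕ.≤ M × C ℕ.* R₂ ℕ.≤ M ×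
     C ℕ.* r₁ ℕ.≤ M ℕ.^ suc k × C ℕ.* r₂ ℕ.≤ M ℕ.^ suc k)
two-scale k C M zero cj≤ = 0 , 0 , 0 , 0 , refl , C0≤ , C0≤ , C0≤ , C0≤
  where
  C0≤ : ∀ {n} → C ℕ.* 0 ℕ.≤ n
  C0≤ = ℕ.≤-trans (ℕ.≤-reflexive (ℕ.*-zeroʳ C)) z≤n
-- Division by `R = M / C`: the quotient gives the translation `R (j / R)`, and the remainder, being
-- below `R`, is paired with `r₂ = 1`. Here `j ≥ 1` forces `C ≤ M`, so that `R` is nonzero; this is
-- why `j = 0` is separate.
two-scale k C M j@(suc _) cj≤ = R , j / R , j % R , 1 ,
  trans (split R (j / R) (j % R)) (sym (m≡m%n+[m/n]*n j R)) ,
  CR≤M , ℕ.≤-trans (ℕ.*-monoʳ-≤ C (ℕ.<⇒≤ (m%n<n j R))) CR≤M ,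
  ℕ.*-cancelʳ-≤ (C ℕ.* (j / R)) (M ℕ.^ suc k) M long ,
  ℕ.≤-trans (ℕ.≤-reflexive (ℕ.*-identityʳ C)) (ℕ.≤-trans C≤M (ℕ.m≤m*n M (M ℕ.^ k) {{ℕ.m^n≢0 M k}}))
  where
  open ℕ.≤-Reasoning
  split : ∀ R q s → R ℕ.* q + s ℕ.* 1 ≡ s + q ℕ.* R
  split = ℕ-Ring.solve-∀
  C≤M : C ℕ.≤ M
  C≤M = ℕ.≮⇒≥ λ M<C → ℕ.<⇒≱ (ℕ.^-monoˡ-< (suc (suc k)) M<C) (ℕ.≤-trans (ℕ.≤-trans
    (ℕ.m≤n*m (C ℕ.^ suc (suc k)) (2 ℕ.* C ℕ.* C) {{ℕ.m*n≢0 (2 ℕ.* C) C {{ℕ.m*n≢0 2 C}}}})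
    (ℕ.m≤m*n (2 ℕ.* C ℕ.* C ℕ.* C ℕ.^ suc (suc k)) j)) cj≤)
  R : ℕ
  R = M / C
  instance
    R≢0 : NonZero R
    R≢0 = ℕ.>-nonZero (m≥n⇒m/n>0 C≤M)
  CR≤M : C ℕ.* R ℕ.≤ M
  CR≤M = ℕ.≤-trans (ℕ.≤-reflexive (ℕ.*-comm C R)) (m/n*n≤m M C)
  M≤2CR : M ℕ.≤ 2 ℕ.* C ℕ.* R
  M≤2CR = begin
    M                        ≡⟨ m≡m%n+[m/n]*n M C ⟩
    M % C + R ℕ.* C          ≤⟨ ℕ.+-monoˡ-≤ (R ℕ.* C) (ℕ.<⇒≤ (m%n<n M C)) ⟩
    C + R ℕ.* C              ≤⟨ ℕ.+-monoˡ-≤ (R ℕ.* C) (ℕ.m≤n*m C R) ⟩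
    R ℕ.* C + R ℕ.* C        ≡⟨ double R C ⟩
    2 ℕ.* C ℕ.* R            ∎
    where
    double : ∀ R C → R ℕ.* C + R ℕ.* C ≡ 2 ℕ.* C ℕ.* R
    double = ℕ-Ring.solve-∀
  long : C ℕ.* (j / R) ℕ.* M ℕ.≤ M ℕ.^ suc k ℕ.* M
  long = begin
    C ℕ.* (j / R) ℕ.* M                              ≤⟨ ℕ.*-monoʳ-≤ (C ℕ.* (j / R)) M≤2CR ⟩
    C ℕ.* (j / R) ℕ.* (2 ℕ.* C ℕ.* R)                ≡⟨ regroup C (j / R) R ⟩
    2 ℕ.* C ℕ.* C ℕ.* (j / R ℕ.* R)                  ≤⟨ ℕ.*-monoʳ-≤ (2 ℕ.* C ℕ.* C) (m/n*n≤m j R) ⟩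
    2 ℕ.* C ℕ.* C ℕ.* j                              ≤⟨ ℕ.*-monoˡ-≤ j (ℕ.m≤m*n (2 ℕ.* C ℕ.* C) (C ℕ.^ suc (suc k)) {{ℕ.m^n≢0 C (suc (suc k))}}) ⟩
    2 ℕ.* C ℕ.* C ℕ.* C ℕ.^ suc (suc k) ℕ.* j        ≤⟨ cj≤ ⟩
    M ℕ.^ suc (suc k)                                ≡⟨ ℕ.*-comm M (M ℕ.^ suc k) ⟩
    M ℕ.^ suc k ℕ.* M                                ∎
    where
    regroup : ∀ C q R → C ℕ.* q ℕ.* (2 ℕ.* C ℕ.* R) ≡ 2 ℕ.* C ℕ.* C ℕ.* (q ℕ.* R)
    regroup = ℕ-Ring.solve-∀

orbitSum-difference-+ : ∀ s M a b f x →
  orbitSum s M (difference (a + b) f) x ≡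
  orbitSum s M (difference a f) x ℤ.+ orbitSum s M (difference b (λ y → f (y + a))) x
orbitSum-difference-+ s M a b f x = trans
  (∑-cong M (λ m → trans (cong (λ z → f (x + s m) ℤ.- f z) (regroup (x + s m) a b)) (telescope (f (x + s m)) (f (x + s m + a)) (f (x + s m + b + a)))))
  (∑-+ M (λ m → difference a f (x + s m)) (λ m → difference b (λ y → f (y + a)) (x + s m)))
  where
  regroup : ∀ x a b → x + (a + b) ≡ x + b + a
  regroup = ℕ-Ring.solve-∀
  telescope : ∀ i j k → i ℤ.- k ≡ i ℤ.- j ℤ.+ (j ℤ.- k)
  telescope = solve-∀

module _ (k κ H′ : ℕ) (56κ≤H : 56 ℕ.* κ ℕ.≤ suc H′) where

  private
    H : ℕ
    H  = suc H′

  -- `two-scale` writes the translation as a sum of two to which `Differencing` applies; its `C`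
  -- exceeds both `6 H²` and `c H !`. Squaring a sum of two terms loses a factor 4, and
  -- `56 = 4 · 14` compensates for this and for the constant of `orbitSum-bound`.
  almostInvariant-suc : ∀ {D c} → AlmostInvariant k (H ℕ.* H) D c →
    ∃[ c′ ] AlmostInvariant (suc k) κ (D ℕ.* H !) c′
  almostInvariant-suc {D} {c} invariant = assemble (suc (6 ℕ.* H ℕ.* H + c ℕ.* H !))
    (ℕ.m≤n⇒m≤1+n (ℕ.m≤m+n (6 ℕ.* H ℕ.* H) (c ℕ.* H !))) (ℕ.m≤n⇒m≤1+n (ℕ.m≤n+m (c ℕ.* H !) (6 ℕ.* H ℕ.* H)))
    where
    result : ∀ C → 6 ℕ.* H ℕ.* H ℕ.≤ C → c ℕ.* H ! ℕ.≤ C →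
      ∀ {W f} → Periodic W f → ∀ {μ s} → HasLeading (suc (suc k)) μ s → ∀ M′ j →
      ∃[ R₁ ] ∃[ r₁ ] ∃[ R₂ ] ∃[ r₂ ]
        (R₁ ℕ.* r₁ + R₂ ℕ.* r₂ ≡ j × C ℕ.* R₁ ℕ.≤ suc M′ × C ℕ.* R₂ ℕ.≤ suc M′ ×
         C ℕ.* r₁ ℕ.≤ suc M′ ℕ.^ suc k × C ℕ.* r₂ ℕ.≤ suc M′ ℕ.^ suc k) →
      + κ ℤ.* norm² W (orbitSum s (suc M′) (difference (D ℕ.* H ! ℕ.* μ ℕ.* j) f)) ℤ.≤ + suc M′ ℤ.* (+ suc M′ ℤ.* norm² W f)
    result C 6H²≤C cH!≤C {W} {f} per {μ} {s} lead M′ j (R₁ , r₁ , R₂ , r₂ , j≡ , CR₁≤ , CR₂≤ , Cr₁≤ , Cr₂≤) =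
      subst (λ y → + κ ℤ.* norm² W (orbitSum s M (difference y f)) ℤ.≤ X) shift≡ combined
      where
      open ℤ.≤-Reasoning
      M : ℕ
      M = suc M′
      X : ℤ
      X = + M ℤ.* (+ M ℤ.* norm² W f)
      E a₁ a₂ : ℕ
      E = D ℕ.* H ! ℕ.* μ
      a₁ = E ℕ.* (R₁ ℕ.* r₁)
      a₂ = E ℕ.* (R₂ ℕ.* r₂)
      f₁ : ℕ → ℤ
      f₁ y = f (y + a₁)
      shift≡ : a₁ + a₂ ≡ E ℕ.* j
      shift≡ = trans (sym (ℕ.*-distribˡ-+ E (R₁ ℕ.* r₁) (R₂ ℕ.* r₂))) (cong (E ℕ.*_) j≡)
      R-small : ∀ {R} → C ℕ.* R ℕ.≤ M → 6 ℕ.* H ℕ.* (H ℕ.* R) ℕ.≤ M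
      R-small {R} CR≤M = ℕ.≤-trans (ℕ.≤-reflexive (sym (ℕ.*-assoc (6 ℕ.* H) H R)))
        (ℕ.≤-trans (ℕ.*-monoˡ-≤ R 6H²≤C) CR≤M)
      r-small : ∀ {r} → C ℕ.* r ℕ.≤ M ℕ.^ suc k → c ℕ.* (H ! ℕ.* r) ℕ.≤ M ℕ.^ suc k
      r-small {r} Cr≤ = ℕ.≤-trans (ℕ.≤-reflexive (sym (ℕ.*-assoc c (H !) r)))
        (ℕ.≤-trans (ℕ.*-monoˡ-≤ r cH!≤C) Cr≤)
      single : ∀ {f} → Periodic W f → ∀ R r → C ℕ.* R ℕ.≤ M → C ℕ.* r ℕ.≤ M ℕ.^ suc k →
        + 4 ℤ.* (+ κ ℤ.* norm² W (orbitSum s M (difference (E ℕ.* (R ℕ.* r)) f))) ℤ.≤ + M ℤ.* (+ M ℤ.* norm² W f)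
      single {f} per R r CR≤ Cr≤ = ℤ.*-cancelˡ-≤-pos _ _ (+ 14) (begin
        + 14 ℤ.* (+ 4 ℤ.* (+ κ ℤ.* N))    ≡⟨ regroup (+ κ) N ⟩
        + 56 ℤ.* + κ ℤ.* N                ≡⟨ cong (ℤ._* N) (ℤ.pos-* 56 κ) ⟨
        + (56 ℕ.* κ) ℤ.* N                ≤⟨ ℤ.*-monoʳ-≤-nonNeg N {{ℤ.nonNegative (norm²-nonneg W (orbitSum s M (difference (E ℕ.* (R ℕ.* r)) f)))}} (ℤ.+≤+ 56κ≤H) ⟩
        + H ℤ.* N                         ≤⟨ Differencing.orbitSum-bound k H′ D c invariant per lead M′ R r (R-small CR≤) (r-small Cr≤) ⟩
        + 14 ℤ.* (+ M ℤ.* (+ M ℤ.* norm² W f)) ∎)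
        where
        N : ℤ
        N = norm² W (orbitSum s M (difference (E ℕ.* (R ℕ.* r)) f))
        regroup : ∀ k n → + 14 ℤ.* (+ 4 ℤ.* (k ℤ.* n)) ≡ + 56 ℤ.* k ℤ.* n
        regroup = solve-∀
      N₁ N₂ : ℤ
      N₁ = norm² W (orbitSum s M (difference a₁ f))
      N₂ = norm² W (orbitSum s M (difference a₂ f₁))
      combined : + κ ℤ.* norm² W (orbitSum s M (difference (a₁ + a₂) f)) ℤ.≤ X
      combined = ℤ.*-cancelˡ-≤-pos _ _ (+ 4) (begin
        + 4 ℤ.* (+ κ ℤ.* norm² W (orbitSum s M (difference (a₁ + a₂) f)))
          ≡⟨ cong (λ y → + 4 ℤ.* (+ κ ℤ.* y)) (norm²-cong W (orbitSum-difference-+ s M a₁ a₂ f)) ⟩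
        + 4 ℤ.* (+ κ ℤ.* norm² W (λ x → orbitSum s M (difference a₁ f) x ℤ.+ orbitSum s M (difference a₂ f₁) x))
          ≤⟨ *-monoˡ-≤-ℕ 4 (*-monoˡ-≤-ℕ κ (norm²-+ W (orbitSum s M (difference a₁ f)) (orbitSum s M (difference a₂ f₁)))) ⟩
        + 4 ℤ.* (+ κ ℤ.* (+ 2 ℤ.* (N₁ ℤ.+ N₂)))
          ≡⟨ expand (+ κ) N₁ N₂ ⟩
        + 2 ℤ.* (+ 4 ℤ.* (+ κ ℤ.* N₁) ℤ.+ + 4 ℤ.* (+ κ ℤ.* N₂))
          ≤⟨ *-monoˡ-≤-ℕ 2 (ℤ.+-mono-≤ (single per R₁ r₁ CR₁≤ Cr₁≤)
               (ℤ.≤-trans (single (periodic-translate per a₁) R₂ r₂ CR₂≤ Cr₂≤)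
                 (ℤ.≤-reflexive (cong (λ y → + M ℤ.* (+ M ℤ.* y)) (norm²-translate per a₁))))) ⟩
        + 2 ℤ.* (X ℤ.+ X)
          ≡⟨ double X ⟩
        + 4 ℤ.* X ∎)
        where
        expand : ∀ k a b → + 4 ℤ.* (k ℤ.* (+ 2 ℤ.* (a ℤ.+ b))) ≡ + 2 ℤ.* (+ 4 ℤ.* (k ℤ.* a) ℤ.+ + 4 ℤ.* (k ℤ.* b))
        expand = solve-∀
        double : ∀ y → + 2 ℤ.* (y ℤ.+ y) ≡ + 4 ℤ.* y
        double = solve-∀

    assemble : ∀ C → .{{NonZero C}} → 6 ℕ.* H ℕ.* H ℕ.≤ C → c ℕ.* H ! ℕ.≤ C → ∃[ c′ ] AlmostInvariant (suc k) κ (D ℕ.* H !) c′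
    assemble C 6H²≤C cH!≤C = 2 ℕ.* C ℕ.* C ℕ.* C ℕ.^ suc (suc k) ,
      λ per {μ} {s} lead M′ j cj≤ → result C 6H²≤C cH!≤C per {μ} {s} lead M′ j (two-scale k C (suc M′) j cj≤)

almostInvariant-step : ∀ k κ → (∀ κ′ → ∃[ D ] ∃[ c ] (NonZero D × AlmostInvariant k κ′ D c)) →
  ∃[ H′ ] (56 ℕ.* κ ℕ.≤ suc H′) → ∃[ D ] ∃[ c ] (NonZero D × AlmostInvariant (suc k) κ D c)
almostInvariant-step k κ hyp (H′ , 56κ≤H) = step (hyp (suc H′ ℕ.* suc H′))
  where
  step : ∃[ D ] ∃[ c ] (NonZero D × AlmostInvariant k (suc H′ ℕ.* suc H′) D c) →
    ∃[ D ] ∃[ c ] (NonZero D × AlmostInvariant (suc k) κ D c)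
  step (D , c , D≢0 , invariant) = D ℕ.* suc H′ ! , proj₁ (almostInvariant-suc k κ H′ 56κ≤H {D} {c} invariant) ,
    ℕ.m*n≢0 D (suc H′ !) {{D≢0}} {{suc H′ ℕ.!≢0}} , proj₂ (almostInvariant-suc k κ H′ 56κ≤H {D} {c} invariant)

-- The induction on the degree must quantify over `κ`: to obtain `κ` in the next degree, the
-- previous one is used with `H²`, where `H = 56 κ + 1`.
almostInvariant : ∀ k κ → ∃[ D ] ∃[ c ] (NonZero D × AlmostInvariant k κ D c)
almostInvariant zero    κ = 1 , 4 ℕ.* κ , _ , almostInvariant-linear κ
almostInvariant (suc k) κ = almostInvariant-step k κ (almostInvariant k) (56 ℕ.* κ , ℕ.n≤1+n (56 ℕ.* κ))

-- Counting sums in a set along a polynomial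

bit : Bool → ℤ
bit false = 0ℤ
bit true  = 1ℤ

0≤bit : ∀ b → 0ℤ ℤ.≤ bit b
0≤bit false = ℤ.≤-refl
0≤bit true  = ℤ.+≤+ z≤n

bit² : ∀ b → bit b ℤ.* bit b ≡ bit b
bit² false = refl
bit² true  = refl

0≤i*j : ∀ {i j} → 0ℤ ℤ.≤ i → 0ℤ ℤ.≤ j → 0ℤ ℤ.≤ i ℤ.* j
0≤i*j {i} {j} 0≤i 0≤j = subst (ℤ._≤ i ℤ.* j) (ℤ.*-zeroʳ i) (ℤ.*-monoˡ-≤-nonNeg i {{ℤ.nonNegative 0≤i}} 0≤j)

module Counting
  (q : ℕ → ℕ) (M′ W′ N Γ G κ : ℕ) (A : ℕ → Bool)
  (A-support  : ∀ y → A y ≡ true → y ℕ.< N)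
  (2N≤W       : N + N ℕ.≤ suc W′)
  (q<W        : ∀ m → m ℕ.< suc M′ → q m ℕ.< suc W′)
  (invariant  : ∀ r → r ℕ.< G → ∀ {f} → Periodic (suc W′) f →
    + κ ℤ.* + κ ℤ.* norm² (suc W′) (orbitSum q (suc M′) (difference (Γ ℕ.* r) f)) ℤ.≤ + suc M′ ℤ.* (+ suc M′ ℤ.* norm² (suc W′) f))
  (represent  : ∀ y z → A y ≡ true → A z ≡ true → ∃[ m ] ∃[ r ] (m ℕ.< suc M′ × r ℕ.< G × q m ≡ y + z + Γ ℕ.* r))
  (no-solution : ∀ y z m → A y ≡ true → A z ≡ true → m ℕ.< suc M′ → y + z ≡ q m → y ≡ z)
  where

  private
    M W : ℕ
    M = suc M′
    W = suc W′

  open ℤ.≤-Reasoning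

  χ f : ℕ → ℤ
  χ y = bit (A y)
  f n = χ (n % W)

  S : ℤ
  S = ∑ W χ

  f-periodic : Periodic W f
  f-periodic x = cong χ (trans (cong (λ y → (x + y) % W) (sym (ℕ.*-identityˡ W))) ([m+kn]%n≡m%n x 1 W))

  -- The translate of `f` by `-Γ r`: as `W′ ≡ -1` modulo `W`, adding `W′ (Γ r)` subtracts `Γ r`.
  F : ℕ → ℕ → ℤ
  F r n = f (n + W′ ℕ.* (Γ ℕ.* r))

  F-periodic : ∀ r → Periodic W (F r)
  F-periodic r = periodic-translate f-periodic (W′ ℕ.* (Γ ℕ.* r))

  F-translate : ∀ r x → F r (x + Γ ℕ.* r) ≡ f x
  F-translate r x = cong χ (trans (cong (_% W) (regroup x (Γ ℕ.* r) W′)) ([m+kn]%n≡m%n x (Γ ℕ.* r) W))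
    where
    regroup : ∀ x g w → x + g + w ℕ.* g ≡ x + g ℕ.* suc w
    regroup = ℕ-Ring.solve-∀

  norm²-χ : norm² W χ ≡ S
  norm²-χ = ∑-cong W (λ y → bit² (A y))

  norm²-F : ∀ r → norm² W (F r) ≡ S
  norm²-F r = trans (norm²-translate f-periodic (W′ ℕ.* (Γ ℕ.* r)))
    (trans (∑-cong< W (λ y y<W → cong (λ z → χ z ℤ.* χ z) (m<n⇒m%n≡m y<W))) norm²-χ)

  -- The sum of `h (q m - y)` over `y` in `A` and `m < M`, with `W ∸ y` in the role of `-y` for
  -- periodic `h`. For `h = F r` it counts the triples with `y + z + Γ r ≡ q m` modulo `W`.
  pairing : (ℕ → ℤ) → ℤ
  pairing h = ∑ W (λ y → χ y ℤ.* orbitSum q M h (W ℕ.∸ y))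

  reflect-sum : ∀ {y n r} → y ℕ.< W → ∀ z → n ≡ y + z + Γ ℕ.* r → z ℕ.< W → F r (W ℕ.∸ y + n) ≡ χ z
  reflect-sum {y} {n} {r} y<W z refl z<W = cong χ (trans (cong (_% W) position) (trans ([m+kn]%n≡m%n z (suc (Γ ℕ.* r)) W) (m<n⇒m%n≡m z<W)))
    where
    regroup : ∀ c y z g w → c + (y + z + g) + w ℕ.* g ≡ z + (c + y + g ℕ.* suc w)
    regroup = ℕ-Ring.solve-∀
    position : W ℕ.∸ y + (y + z + Γ ℕ.* r) + W′ ℕ.* (Γ ℕ.* r) ≡ z + suc (Γ ℕ.* r) ℕ.* W
    position = trans (regroup (W ℕ.∸ y) y z (Γ ℕ.* r) W′) (cong (λ c → z + (c + Γ ℕ.* r ℕ.* W)) (ℕ.m∸n+n≡m (ℕ.<⇒≤ y<W)))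

  -- Double counting with the indicator `I` of true equalities: each `z` in `A` is reached by some
  -- `(r, m)`, and each `(r, m)` reaches at most one `z`. Coincidences that hold only modulo `W`
  -- merely enlarge the right-hand side.
  S≤representations : ∀ y → y ℕ.< W → A y ≡ true → S ℤ.≤ ∑ G (λ r → orbitSum q M (F r) (W ℕ.∸ y))
  S≤representations y y<W Ay = begin
    S
      ≤⟨ ∑-mono W (λ z _ → lower z) ⟩
    ∑ W (λ z → ∑ G (λ r → ∑ M (λ m → I z r m)))
      ≡⟨ ∑-swap W G (λ z r → ∑ M (I z r)) ⟩
    ∑ G (λ r → ∑ W (λ z → ∑ M (λ m → I z r m)))
      ≡⟨ ∑-cong G (λ r → ∑-swap W M (λ z m → I z r m)) ⟩
    ∑ G (λ r → ∑ M (λ m → ∑ W (λ z → I z r m)))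
      ≤⟨ ∑-mono G (λ r _ → ∑-mono M (λ m _ → upper r m)) ⟩
    ∑ G (λ r → orbitSum q M (F r) (W ℕ.∸ y)) ∎
    where
    I : ℕ → ℕ → ℕ → ℤ
    I z r m = χ z ℤ.* kronecker (q m) (y + z + Γ ℕ.* r)
    0≤I : ∀ z r m → 0ℤ ℤ.≤ I z r m
    0≤I z r m = 0≤i*j (0≤bit (A z)) (0≤kronecker (q m) (y + z + Γ ℕ.* r))
    lower : ∀ z → χ z ℤ.≤ ∑ G (λ r → ∑ M (λ m → I z r m))
    lower z with A z in Az
    ... | false = ∑-nonneg G (λ r → ∑-nonneg M (λ m → ℤ.≤-refl))
    ... | true with represent y z Ay Az
    ...   | m , r , m<M , r<G , eq = begin
      1ℤ                                                          ≡⟨ kronecker-refl (q m) ⟨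
      kronecker (q m) (q m)                                       ≡⟨ cong (kronecker (q m)) eq ⟩
      kronecker (q m) (y + z + Γ ℕ.* r)                           ≡⟨ ℤ.*-identityˡ _ ⟨
      1ℤ ℤ.* kronecker (q m) (y + z + Γ ℕ.* r)                    ≤⟨ ∑-term M (λ m → 0≤n*i 1 (0≤kronecker (q m) (y + z + Γ ℕ.* r))) m<M ⟩
      ∑ M (λ m → 1ℤ ℤ.* kronecker (q m) (y + z + Γ ℕ.* r))        ≤⟨ ∑-term G (λ r → ∑-nonneg M (λ m → 0≤n*i 1 (0≤kronecker (q m) (y + z + Γ ℕ.* r)))) r<G ⟩
      ∑ G (λ r → ∑ M (λ m → 1ℤ ℤ.* kronecker (q m) (y + z + Γ ℕ.* r))) ∎
    positive : ∀ {b t i} → 0ℤ ℤ.< bit b ℤ.* kronecker t i → t ≡ i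
    positive {false} (ℤ.+<+ ())
    positive {true} {t} {i} p = kronecker-support i (subst (0ℤ ℤ.<_) (ℤ.*-identityˡ (kronecker t i)) p)
    upper : ∀ r m → ∑ W (λ z → I z r m) ℤ.≤ F r (W ℕ.∸ y + q m)
    upper r m = ∑-at-most-one W (0≤bit _) bound
      (λ i j _ _ pᵢ pⱼ → ℕ.+-cancelˡ-≡ y i j (ℕ.+-cancelʳ-≡ (Γ ℕ.* r) (y + i) (y + j) (trans (sym (positive {A i} pᵢ)) (positive {A j} pⱼ))))
      where
      bound : ∀ z → z ℕ.< W → I z r m ℤ.≤ F r (W ℕ.∸ y + q m)
      bound z z<W with q m ℕ.≟ y + z + Γ ℕ.* r
      ... | yes eq = ℤ.≤-reflexive (trans (ℤ.*-identityʳ (χ z)) (sym (reflect-sum {r = r} y<W z eq z<W)))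
      ... | no _   = ℤ.≤-trans (ℤ.≤-reflexive (ℤ.*-zeroʳ (χ z))) (0≤bit _)

  S²≤∑-pairing : S ℤ.* S ℤ.≤ ∑ G (λ r → pairing (F r))
  S²≤∑-pairing = begin
    S ℤ.* S
      ≡⟨ ∑-*ˡ W S χ ⟩
    ∑ W (λ y → S ℤ.* χ y)
      ≤⟨ ∑-mono W pointwise ⟩
    ∑ W (λ y → ∑ G (λ r → χ y ℤ.* orbitSum q M (F r) (W ℕ.∸ y)))
      ≡⟨ ∑-swap W G (λ y r → χ y ℤ.* orbitSum q M (F r) (W ℕ.∸ y)) ⟩
    ∑ G (λ r → pairing (F r)) ∎
    where
    pointwise : ∀ y → y ℕ.< W → S ℤ.* χ y ℤ.≤ ∑ G (λ r → χ y ℤ.* orbitSum q M (F r) (W ℕ.∸ y))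
    pointwise y y<W with A y in Ay
    ... | false = ℤ.≤-trans (ℤ.≤-reflexive (ℤ.*-zeroʳ S)) (∑-nonneg G (λ r → ℤ.≤-refl))
    ... | true  = ℤ.≤-trans (ℤ.≤-reflexive (ℤ.*-identityʳ S)) (ℤ.≤-trans (S≤representations y y<W Ay)
      (ℤ.≤-reflexive (∑-cong G (λ r → sym (ℤ.*-identityˡ (orbitSum q M (F r) (W ℕ.∸ y)))))))

  -- There is no wrap-around: `y + z` and `q m` are congruent modulo `W` and both lie in `[0, W)`.
  -- The quotient 1 is the one period introduced by `W ∸ y`.
  sum-of-residue : ∀ {y m} → A y ≡ true → A ((W ℕ.∸ y + q m) % W) ≡ true → m ℕ.< M → y + (W ℕ.∸ y + q m) % W ≡ q m
  sum-of-residue {y} {m} Ay Az m<M = by-quotient ((W ℕ.∸ y + q m) / W) total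
    where
    z : ℕ
    z = (W ℕ.∸ y + q m) % W
    y+z<W : y + z ℕ.< W
    y+z<W = ℕ.≤-trans (ℕ.+-mono-<-≤ (A-support y Ay) (ℕ.<⇒≤ (A-support z Az))) 2N≤W
    y≤W : y ℕ.≤ W
    y≤W = ℕ.≤-trans (ℕ.m≤m+n y z) (ℕ.<⇒≤ y+z<W)
    total : W + q m ≡ y + z + (W ℕ.∸ y + q m) / W ℕ.* W
    total = trans (cong (_+ q m) (sym (ℕ.m+[n∸m]≡n y≤W))) (trans (ℕ.+-assoc y (W ℕ.∸ y) (q m))
      (trans (cong (y ℕ.+_) (m≡m%n+[m/n]*n (W ℕ.∸ y + q m) W)) (sym (ℕ.+-assoc y z _))))
    by-quotient : ∀ e → W + q m ≡ y + z + e ℕ.* W → y + z ≡ q m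
    by-quotient zero eq = ⊥-elim (ℕ.<⇒≱ y+z<W (ℕ.≤-trans (ℕ.m≤m+n W (q m)) (ℕ.≤-reflexive (trans eq (ℕ.+-identityʳ (y + z))))))
    by-quotient (suc zero) eq = sym (ℕ.+-cancelˡ-≡ W (q m) (y + z) (trans eq (swap (y + z) W)))
      where
      swap : ∀ s w → s + (w + 0) ≡ w + s
      swap = ℕ-Ring.solve-∀
    by-quotient (suc (suc e)) eq = ⊥-elim (ℕ.<⇒≱ (q<W m m<M) (ℕ.+-cancelˡ-≤ W W (q m) (ℕ.≤-trans
      (ℕ.≤-trans (ℕ.+-monoʳ-≤ W (ℕ.m≤m+n W (e ℕ.* W))) (ℕ.m≤n+m _ (y + z))) (ℕ.≤-reflexive (sym eq)))))

  -- By `no-solution` only `y = z` is counted, and `y + y = q m` determines `y`.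
  pairing-f≤M : pairing f ℤ.≤ + M
  pairing-f≤M = begin
    pairing f
      ≡⟨ ∑-cong W (λ y → ∑-*ˡ M (χ y) (λ m → f (W ℕ.∸ y + q m))) ⟩
    ∑ W (λ y → ∑ M (λ m → χ y ℤ.* f (W ℕ.∸ y + q m)))
      ≡⟨ ∑-swap W M (λ y m → χ y ℤ.* f (W ℕ.∸ y + q m)) ⟩
    ∑ M (λ m → ∑ W (λ y → χ y ℤ.* f (W ℕ.∸ y + q m)))
      ≤⟨ ∑-mono M at-most-one ⟩
    ∑ M (λ _ → 1ℤ)
      ≡⟨ trans (∑-const M 1ℤ) (ℤ.*-identityʳ (+ M)) ⟩
    + M ∎
    where
    bit*bit≤1 : ∀ b c → bit b ℤ.* bit c ℤ.≤ 1ℤ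
    bit*bit≤1 false c     = ℤ.+≤+ z≤n
    bit*bit≤1 true  false = ℤ.+≤+ z≤n
    bit*bit≤1 true  true  = ℤ.≤-refl
    bit*bit>0 : ∀ b c → 0ℤ ℤ.< bit b ℤ.* bit c → b ≡ true × c ≡ true
    bit*bit>0 false c     (ℤ.+<+ ())
    bit*bit>0 true  false (ℤ.+<+ ())
    bit*bit>0 true  true  _ = refl , refl
    at-most-one : ∀ m → m ℕ.< M → ∑ W (λ y → χ y ℤ.* f (W ℕ.∸ y + q m)) ℤ.≤ 1ℤ
    at-most-one m m<M = ∑-at-most-one W (ℤ.+≤+ z≤n) (λ y _ → bit*bit≤1 (A y) (A ((W ℕ.∸ y + q m) % W)))
      (λ i j _ _ pᵢ pⱼ → halve (trans (double i pᵢ) (sym (double j pⱼ))))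
      where
      double : ∀ y → 0ℤ ℤ.< χ y ℤ.* f (W ℕ.∸ y + q m) → y + y ≡ q m
      double y p with bit*bit>0 (A y) (A ((W ℕ.∸ y + q m) % W)) p
      ... | Ay , Az = trans (cong (y ℕ.+_) (no-solution y _ m Ay Az m<M sum)) sum
        where
        sum : y + (W ℕ.∸ y + q m) % W ≡ q m
        sum = sum-of-residue {y} {m} Ay Az m<M
      halve : ∀ {i j} → i + i ≡ j + j → i ≡ j
      halve {i} {j} eq with ℕ.<-cmp i j
      ... | tri< i<j _ _ = ⊥-elim (ℕ.<⇒≢ (ℕ.+-mono-< i<j i<j) eq)
      ... | tri≈ _ i≡j _ = i≡j
      ... | tri> _ _ j<i = ⊥-elim (ℕ.<⇒≢ (ℕ.+-mono-< j<i j<i) (sym eq))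

  -- `F r - f` is `difference (Γ r) (F r)`, whose sum `V` along `q` is small in ℓ². Since
  -- `invariant` carries `κ²`, Young's inequality with weights `M` and `κ` bounds the inner product
  -- of `χ` with the reflected `V` by `M S / κ`.
  pairing-F≤ : ∀ r → r ℕ.< G → + κ ℤ.* pairing (F r) ℤ.≤ + κ ℤ.* + M ℤ.+ + M ℤ.* S
  pairing-F≤ r r<G = begin
    + κ ℤ.* pairing (F r)
      ≡⟨ cong (+ κ ℤ.*_) split ⟩
    + κ ℤ.* (pairing f ℤ.+ X)
      ≡⟨ ℤ.*-distribˡ-+ (+ κ) (pairing f) X ⟩
    + κ ℤ.* pairing f ℤ.+ + κ ℤ.* X
      ≤⟨ ℤ.+-mono-≤ (*-monoˡ-≤-ℕ κ pairing-f≤M) X≤ ⟩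
    + κ ℤ.* + M ℤ.+ + M ℤ.* S ∎
    where
    g V : ℕ → ℤ
    g = difference (Γ ℕ.* r) (F r)
    V = orbitSum q M g
    X : ℤ
    X = ∑ W (λ y → χ y ℤ.* V (W ℕ.∸ y))
    V-periodic : Periodic W V
    V-periodic x = ∑-cong M (λ m → trans (cong g (swap x W (q m))) (periodic-difference (F-periodic r) (Γ ℕ.* r) (x + q m)))
      where
      swap : ∀ x w y → x + w + y ≡ x + y + w
      swap = ℕ-Ring.solve-∀
    split : pairing (F r) ≡ pairing f ℤ.+ X
    split = trans (∑-cong W (λ y → trans (cong (χ y ℤ.*_) (splitOrbit (W ℕ.∸ y))) (ℤ.*-distribˡ-+ (χ y) _ _)))
      (∑-+ W (λ y → χ y ℤ.* orbitSum q M f (W ℕ.∸ y)) (λ y → χ y ℤ.* V (W ℕ.∸ y)))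
      where
      complete : ∀ i j → i ≡ j ℤ.+ (i ℤ.- j)
      complete = solve-∀
      splitOrbit : ∀ x → orbitSum q M (F r) x ≡ orbitSum q M f x ℤ.+ V x
      splitOrbit x = trans
        (∑-cong M (λ m → trans (complete (F r (x + q m)) (f (x + q m)))
          (cong (λ t → f (x + q m) ℤ.+ (F r (x + q m) ℤ.- t)) (sym (F-translate r (x + q m))))))
        (∑-+ M (λ m → f (x + q m)) (λ m → g (x + q m)))
    norm²-reflect : norm² W (λ y → V (W ℕ.∸ y)) ≡ norm² W V
    norm²-reflect = begin-equality
      norm² W (λ y → V (W ℕ.∸ y))      ≡⟨ ∑-reverse W (λ x → V x ℤ.* V x) ⟩
      norm² W (λ x → V (suc x))        ≡⟨ ∑-cong W (λ x → cong (λ y → V y ℤ.* V y) (sym (ℕ.+-comm x 1))) ⟩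
      norm² W (λ x → V (x + 1))        ≡⟨ norm²-translate V-periodic 1 ⟩
      norm² W V                        ∎
    X≤ : + κ ℤ.* X ℤ.≤ + M ℤ.* S
    X≤ = ℤ.*-cancelˡ-≤-pos (+ κ ℤ.* X) (+ M ℤ.* S) (+ 2) (ℤ.*-cancelˡ-≤-pos (+ 2 ℤ.* (+ κ ℤ.* X)) (+ 2 ℤ.* (+ M ℤ.* S)) (+ M) (begin
      + M ℤ.* (+ 2 ℤ.* (+ κ ℤ.* X))
        ≡⟨ cong (+ M ℤ.*_) (sym (ℤ.*-assoc (+ 2) (+ κ) X)) ⟩
      + M ℤ.* (+ 2 ℤ.* + κ ℤ.* X)
        ≤⟨ ∑-young W (+ M) (+ κ) χ (λ y → V (W ℕ.∸ y)) ⟩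
      + M ℤ.* (+ M ℤ.* norm² W χ) ℤ.+ + κ ℤ.* + κ ℤ.* norm² W (λ y → V (W ℕ.∸ y))
        ≡⟨ cong₂ (λ s t → + M ℤ.* (+ M ℤ.* s) ℤ.+ + κ ℤ.* + κ ℤ.* t) norm²-χ norm²-reflect ⟩
      + M ℤ.* (+ M ℤ.* S) ℤ.+ + κ ℤ.* + κ ℤ.* norm² W V
        ≤⟨ ℤ.+-monoʳ-≤ (+ M ℤ.* (+ M ℤ.* S)) (invariant r r<G (F-periodic r)) ⟩
      + M ℤ.* (+ M ℤ.* S) ℤ.+ + M ℤ.* (+ M ℤ.* norm² W (F r))
        ≡⟨ cong (λ s → + M ℤ.* (+ M ℤ.* S) ℤ.+ + M ℤ.* (+ M ℤ.* s)) (norm²-F r) ⟩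
      + M ℤ.* (+ M ℤ.* S) ℤ.+ + M ℤ.* (+ M ℤ.* S)
        ≡⟨ double (+ M) S ⟩
      + M ℤ.* (+ 2 ℤ.* (+ M ℤ.* S)) ∎))
      where
      double : ∀ m s → m ℤ.* (m ℤ.* s) ℤ.+ m ℤ.* (m ℤ.* s) ≡ m ℤ.* (+ 2 ℤ.* (m ℤ.* s))
      double = solve-∀

  S²-bound : + κ ℤ.* (S ℤ.* S) ℤ.≤ + G ℤ.* (+ M ℤ.* (+ κ ℤ.+ S))
  S²-bound = begin
    + κ ℤ.* (S ℤ.* S)                            ≤⟨ *-monoˡ-≤-ℕ κ S²≤∑-pairing ⟩
    + κ ℤ.* ∑ G (λ r → pairing (F r))            ≡⟨ ∑-*ˡ G (+ κ) (λ r → pairing (F r)) ⟩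
    ∑ G (λ r → + κ ℤ.* pairing (F r))            ≤⟨ ∑-mono G pairing-F≤ ⟩
    ∑ G (λ _ → + κ ℤ.* + M ℤ.+ + M ℤ.* S)        ≡⟨ ∑-const G (+ κ ℤ.* + M ℤ.+ + M ℤ.* S) ⟩
    + G ℤ.* (+ κ ℤ.* + M ℤ.+ + M ℤ.* S)          ≡⟨ collect (+ G) (+ κ) (+ M) S ⟩
    + G ℤ.* (+ M ℤ.* (+ κ ℤ.+ S))                ∎
    where
    collect : ∀ g k m s → g ℤ.* (k ℤ.* m ℤ.+ m ℤ.* s) ≡ g ℤ.* (m ℤ.* (k ℤ.+ s))
    collect = solve-∀

-- Polynomials with natural coefficients

infixr 5 _∷_

-- Degree k, leading coefficient ℓ; the constant term comes first.
data Poly (ℓ : ℕ) : ℕ → Set where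
  lead : Poly ℓ 0
  _∷_  : ∀ {k} → ℕ → Poly ℓ k → Poly ℓ (suc k)

⟦_⟧ : ∀ {ℓ k} → Poly ℓ k → ℕ → ℕ
⟦_⟧ {ℓ} lead x = ℓ
⟦ a ∷ p ⟧    x = a + x ℕ.* ⟦ p ⟧ x

hasLeading-≡ : ∀ k {μ ν s} → μ ≡ ν → HasLeading k μ s → HasLeading k ν s
hasLeading-≡ k refl ls = ls

hasLeading-+ : ∀ k {μ ν s t} → HasLeading k μ s → HasLeading k ν t → HasLeading k (μ + ν) (λ m → s m + t m)
hasLeading-+ zero    ls lt m = cong₂ _+_ (ls m) (lt m)
hasLeading-+ (suc k) {μ} {ν} {s} {t} ls lt h with ls h | lt h
... | δ , lδ , δ-eq | ε , lε , ε-eq = (λ m → δ m + ε m) ,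
  hasLeading-≡ k (sym (ℕ.*-distribˡ-+ h μ ν)) (hasLeading-+ k lδ lε) ,
  λ m → trans (cong₂ _+_ (δ-eq m) (ε-eq m)) (exchange (s m) (δ m) (t m) (ε m))
  where
  exchange : ∀ a b c d → (a + b) + (c + d) ≡ (a + c) + (b + d)
  exchange = ℕ-Ring.solve-∀

hasLeading-* : ∀ k {μ s} c → HasLeading k μ s → HasLeading k (c ℕ.* μ) (λ m → c ℕ.* s m)
hasLeading-* zero    c ls m = cong (c ℕ.*_) (ls m)
hasLeading-* (suc k) {μ} {s} c ls h with ls h
... | δ , lδ , eq = (λ m → c ℕ.* δ m) ,
  hasLeading-≡ k (commute c h μ) (hasLeading-* k c lδ) ,
  λ m → trans (cong (c ℕ.*_) (eq m)) (ℕ.*-distribˡ-+ c (s m) (δ m))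
  where
  commute : ∀ c h μ → c ℕ.* (h ℕ.* μ) ≡ h ℕ.* (c ℕ.* μ)
  commute = ℕ-Ring.solve-∀

hasLeading-0 : ∀ k → HasLeading k 0 (λ _ → 0)
hasLeading-0 zero    m = refl
hasLeading-0 (suc k) h = (λ _ → 0) , hasLeading-≡ k (sym (ℕ.*-zeroʳ h)) (hasLeading-0 k) , λ _ → refl

hasLeading-const : ∀ k a → HasLeading (suc k) 0 (λ _ → a)
hasLeading-const k a h = (λ _ → 0) , hasLeading-≡ k (sym (ℕ.*-zeroʳ h)) (hasLeading-0 k) ,
  λ _ → sym (ℕ.+-identityʳ a)

-- Product rule: (m + h) s (m + h) - m s m = m δ m + h s (m + h).
hasLeading-x* : ∀ k {μ s} → HasLeading k μ s → HasLeading (suc k) (suc k ℕ.* μ) (λ m → m ℕ.* s m)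
hasLeading-x* zero {μ} {s} ls h = (λ _ → h ℕ.* μ) , (λ _ → cong (h ℕ.*_) (sym (ℕ.*-identityˡ μ))) ,
  λ m → trans (cong ((m + h) ℕ.*_) (ls (m + h))) (trans (ℕ.*-distribʳ-+ μ m h) (cong (λ y → m ℕ.* y + h ℕ.* μ) (sym (ls m))))
hasLeading-x* (suc k) {μ} {s} ls h with ls h
... | δ , lδ , eq = (λ m → m ℕ.* δ m + h ℕ.* s (h + m)) ,
  hasLeading-≡ (suc k) (collect k h μ)
    (hasLeading-+ (suc k) (hasLeading-x* k lδ) (hasLeading-* (suc k) h (hasLeading-shift (suc k) ls h))) ,
  λ m → trans (cong ((m + h) ℕ.*_) (eq m)) (trans (expand m h (s m) (δ m))
    (cong (λ y → m ℕ.* s m + (m ℕ.* δ m + h ℕ.* y)) (trans (sym (eq m)) (cong s (ℕ.+-comm m h)))))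
  where
  collect : ∀ k h μ → suc k ℕ.* (h ℕ.* μ) + h ℕ.* μ ≡ h ℕ.* (suc (suc k) ℕ.* μ)
  collect = ℕ-Ring.solve-∀
  expand : ∀ m h s d → (m + h) ℕ.* (s + d) ≡ m ℕ.* s + (m ℕ.* d + h ℕ.* (s + d))
  expand = ℕ-Ring.solve-∀

hasLeading-⟦⟧ : ∀ {ℓ k} (p : Poly ℓ k) → HasLeading k (k ! ℕ.* ℓ) ⟦ p ⟧
hasLeading-⟦⟧ {ℓ} lead m = sym (ℕ.*-identityˡ ℓ)
hasLeading-⟦⟧ {ℓ} {suc k} (a ∷ p) = hasLeading-≡ (suc k) (sym (ℕ.*-assoc (suc k) (k !) ℓ))
  (hasLeading-+ (suc k) (hasLeading-const k a) (hasLeading-x* k (hasLeading-⟦⟧ p)))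

forward-difference : ∀ {ℓ k} → Poly ℓ k → ℕ → ℕ
forward-difference lead    x = 0
forward-difference (a ∷ p) x = ⟦ p ⟧ (suc x) + x ℕ.* forward-difference p x

⟦⟧-suc : ∀ {ℓ k} (p : Poly ℓ k) x → ⟦ p ⟧ (suc x) ≡ ⟦ p ⟧ x + forward-difference p x
⟦⟧-suc {ℓ} lead x = sym (ℕ.+-identityʳ ℓ)
⟦⟧-suc (a ∷ p)  x = begin
  a + suc x ℕ.* ⟦ p ⟧ (suc x)                                              ≡⟨ expand a x (⟦ p ⟧ (suc x)) ⟩
  a + x ℕ.* ⟦ p ⟧ (suc x) + ⟦ p ⟧ (suc x)                                  ≡⟨ cong (λ y → a + x ℕ.* y + ⟦ p ⟧ (suc x)) (⟦⟧-suc p x) ⟩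
  a + x ℕ.* (⟦ p ⟧ x + forward-difference p x) + ⟦ p ⟧ (suc x)             ≡⟨ collect a x (⟦ p ⟧ x) (forward-difference p x) (⟦ p ⟧ (suc x)) ⟩
  a + x ℕ.* ⟦ p ⟧ x + (⟦ p ⟧ (suc x) + x ℕ.* forward-difference p x)       ∎
  where
  open ≡-Reasoning
  expand : ∀ a x y → a + suc x ℕ.* y ≡ a + x ℕ.* y + y
  expand = ℕ-Ring.solve-∀
  collect : ∀ a x u v w → a + x ℕ.* (u + v) + w ≡ a + x ℕ.* u + (w + x ℕ.* v)
  collect = ℕ-Ring.solve-∀

⟦⟧-mono : ∀ {ℓ k} (p : Poly ℓ k) {x y} → x ℕ.≤ y → ⟦ p ⟧ x ℕ.≤ ⟦ p ⟧ y
⟦⟧-mono lead    x≤y = ℕ.≤-refl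
⟦⟧-mono (a ∷ p) x≤y = ℕ.+-monoʳ-≤ a (ℕ.*-mono-≤ x≤y (⟦⟧-mono p x≤y))

forward-difference-mono : ∀ {ℓ k} (p : Poly ℓ k) {x y} → x ℕ.≤ y → forward-difference p x ℕ.≤ forward-difference p y
forward-difference-mono lead    x≤y = ℕ.≤-refl
forward-difference-mono (a ∷ p) x≤y =
  ℕ.+-mono-≤ (⟦⟧-mono p (s≤s x≤y)) (ℕ.*-mono-≤ x≤y (forward-difference-mono p x≤y))

-- Natural coefficients make the forward differences monotone, so each of the `j` steps from `x`
-- rises by at least the first. With `j = x = M` this bounds `M G` by a value of the polynomial.
⟦⟧-convex : ∀ {ℓ k} (p : Poly ℓ k) x j → j ℕ.* forward-difference p x ℕ.≤ ⟦ p ⟧ (j + x)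
⟦⟧-convex p x zero    = z≤n
⟦⟧-convex p x (suc j) = begin
  forward-difference p x + j ℕ.* forward-difference p x     ≤⟨ ℕ.+-mono-≤ (forward-difference-mono p (ℕ.m≤n+m x j)) (⟦⟧-convex p x j) ⟩
  forward-difference p (j + x) + ⟦ p ⟧ (j + x)              ≡⟨ ℕ.+-comm (forward-difference p (j + x)) (⟦ p ⟧ (j + x)) ⟩
  ⟦ p ⟧ (j + x) + forward-difference p (j + x)              ≡⟨ ⟦⟧-suc p (j + x) ⟨
  ⟦ p ⟧ (suc j + x)                                         ∎
  where open ℕ.≤-Reasoning

⟦⟧-double : ∀ {ℓ k} (p : Poly ℓ k) x → ⟦ p ⟧ (x + x) ℕ.≤ 2 ℕ.^ k ℕ.* ⟦ p ⟧ x
⟦⟧-double {ℓ} lead x = ℕ.≤-reflexive (sym (ℕ.*-identityˡ ℓ))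
⟦⟧-double {k = suc k} (a ∷ p) x = begin
  a + (x + x) ℕ.* ⟦ p ⟧ (x + x)                      ≤⟨ ℕ.+-mono-≤ (ℕ.m≤n*m a (2 ℕ.^ suc k) {{ℕ.m^n≢0 2 (suc k)}}) (ℕ.*-monoʳ-≤ (x + x) (⟦⟧-double p x)) ⟩
  2 ℕ.^ suc k ℕ.* a + (x + x) ℕ.* (2 ℕ.^ k ℕ.* ⟦ p ⟧ x)  ≡⟨ collect (2 ℕ.^ k) a x (⟦ p ⟧ x) ⟩
  2 ℕ.^ suc k ℕ.* (a + x ℕ.* ⟦ p ⟧ x)                ∎
  where
  open ℕ.≤-Reasoning
  collect : ∀ t a x y → (2 ℕ.* t) ℕ.* a + (x + x) ℕ.* (t ℕ.* y) ≡ (2 ℕ.* t) ℕ.* (a + x ℕ.* y)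
  collect = ℕ-Ring.solve-∀

⟦⟧≤⟦⟧1*^ : ∀ {ℓ k} (p : Poly ℓ k) x → .{{NonZero x}} → ⟦ p ⟧ x ℕ.≤ ⟦ p ⟧ 1 ℕ.* x ℕ.^ k
⟦⟧≤⟦⟧1*^ {ℓ} lead x = ℕ.≤-reflexive (sym (ℕ.*-identityʳ ℓ))
⟦⟧≤⟦⟧1*^ {k = suc k} (a ∷ p) x = begin
  a + x ℕ.* ⟦ p ⟧ x                                        ≤⟨ ℕ.+-mono-≤ (ℕ.m≤m*n a (x ℕ.^ suc k) {{ℕ.m^n≢0 x (suc k)}}) (ℕ.*-monoʳ-≤ x (⟦⟧≤⟦⟧1*^ p x)) ⟩
  a ℕ.* x ℕ.^ suc k + x ℕ.* (⟦ p ⟧ 1 ℕ.* x ℕ.^ k)          ≡⟨ collect a x (⟦ p ⟧ 1) (x ℕ.^ k) ⟩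
  (a + 1 ℕ.* ⟦ p ⟧ 1) ℕ.* x ℕ.^ suc k                      ∎
  where
  open ℕ.≤-Reasoning
  collect : ∀ a x b t → a ℕ.* (x ℕ.* t) + x ℕ.* (b ℕ.* t) ≡ (a + 1 ℕ.* b) ℕ.* (x ℕ.* t)
  collect = ℕ-Ring.solve-∀

-- Normalisation to a polynomial congruent to the identity modulo `E`

Congruential : (ℕ → ℕ) → Set
Congruential w = ∀ m x → ∃[ v ] w (m + x) ≡ w m + x ℕ.* v

⟦⟧-congruential : ∀ {ℓ k} (p : Poly ℓ k) → Congruential ⟦ p ⟧
⟦⟧-congruential {ℓ} lead m x = 0 , sym (trans (cong (ℓ ℕ.+_) (ℕ.*-zeroʳ x)) (ℕ.+-identityʳ ℓ))
⟦⟧-congruential (a ∷ p)  m x with ⟦⟧-congruential p m x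
... | v , eq = ⟦ p ⟧ m + (m + x) ℕ.* v , trans (cong (λ y → a + (m + x) ℕ.* y) eq) (expand a m x (⟦ p ⟧ m) v)
  where
  expand : ∀ a m x r v → a + (m + x) ℕ.* (r + x ℕ.* v) ≡ a + m ℕ.* r + x ℕ.* (r + (m + x) ℕ.* v)
  expand = ℕ-Ring.solve-∀

-- This is `e y^k ℓ`, accumulated in the same order as the coefficients in `scale`, so that the
-- index of `scale` agrees by computation.
scaledLead : (e y ℓ k : ℕ) → ℕ
scaledLead e y ℓ zero    = e ℕ.* ℓ
scaledLead e y ℓ (suc k) = scaledLead (e ℕ.* y) y ℓ k

scale : ∀ {ℓ k} e y → Poly ℓ k → Poly (scaledLead e y ℓ k) k
scale e y lead    = lead
scale e y (a ∷ p) = e ℕ.* a ∷ scale (e ℕ.* y) y p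

⟦scale⟧ : ∀ {ℓ k} e y (p : Poly ℓ k) x → ⟦ scale e y p ⟧ x ≡ e ℕ.* ⟦ p ⟧ (y ℕ.* x)
⟦scale⟧ e y lead    x = refl
⟦scale⟧ e y (a ∷ p) x = trans (cong (λ t → e ℕ.* a + x ℕ.* t) (⟦scale⟧ (e ℕ.* y) y p x)) (collect e y a x (⟦ p ⟧ (y ℕ.* x)))
  where
  collect : ∀ e y a x r → e ℕ.* a + x ℕ.* (e ℕ.* y ℕ.* r) ≡ e ℕ.* (a + y ℕ.* x ℕ.* r)
  collect = ℕ-Ring.solve-∀

-- Each degree contributes one factor `y = c E`, which divides `E²` when `c` divides `E`. The
-- exponent itself is immaterial because `Γ` may be any power of `E`.
scaledLead-∣ : ∀ {E e y i} ℓ k → e ∣ℕ E ℕ.^ i → y ∣ℕ E ℕ.^ 2 → ∃[ j ] scaledLead e y ℓ k ∣ℕ E ℕ.^ j ℕ.* ℓ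
scaledLead-∣ {i = i} ℓ zero e∣ y∣ = i , ℕ∣.*-monoˡ-∣ ℓ e∣
scaledLead-∣ {E} {i = i} ℓ (suc k) e∣ y∣ =
  scaledLead-∣ {i = i + 2} ℓ k (subst (_ ∣ℕ_) (sym (ℕ.^-distribˡ-+-* E i 2)) (ℕ∣.*-pres-∣ e∣ y∣)) y∣

constantTerm : ∀ {ℓ k} → Poly ℓ k → ℕ
constantTerm {ℓ} lead = ℓ
constantTerm (a ∷ p)  = a

-- For c the linear coefficient of P(t) = t R(t), substituting t = c E m and
-- dividing by c² E leaves q(m) ≡ m modulo E.
record Normalisation {ℓ k} (R : Poly ℓ k) (E : ℕ) : Set where
  field
    {leading}    : ℕ
    q            : Poly leading (suc k)
    q0≡0         : ⟦ q ⟧ 0 ≡ 0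
    remainder    : ℕ → ℕ
    congruential : Congruential remainder
    q≡           : ∀ m → ⟦ q ⟧ m ≡ m + E ℕ.* remainder m
    leading-∣    : constantTerm R ∣ℕ E → ∃[ j ] leading ∣ℕ E ℕ.^ j ℕ.* ℓ
    q-scaled     : let c = constantTerm R in
      ∀ m → c ℕ.* (c ℕ.* E) ℕ.* ⟦ q ⟧ m ≡ c ℕ.* E ℕ.* m ℕ.* ⟦ R ⟧ (c ℕ.* E ℕ.* m)

normalise : ∀ {ℓ k} (R : Poly ℓ k) E → Normalisation R E
normalise {ℓ} lead E = record
  { q            = 0 ∷ lead {1}
  ; q0≡0         = refl
  ; remainder    = λ _ → 0
  ; congruential = λ m x → 0 , sym (ℕ.*-zeroʳ x)
  ; q≡           = λ m → linear m E
  ; leading-∣    = λ _ → 0 , ℕ∣.1∣ _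
  ; q-scaled     = λ m → scaled ℓ E m
  }
  where
  linear : ∀ m E → 0 + m ℕ.* 1 ≡ m + E ℕ.* 0
  linear = ℕ-Ring.solve-∀
  scaled : ∀ c E m → c ℕ.* (c ℕ.* E) ℕ.* (0 + m ℕ.* 1) ≡ c ℕ.* E ℕ.* m ℕ.* c
  scaled = ℕ-Ring.solve-∀
normalise {ℓ} {suc k} (c ∷ h) E = record
  -- For `R(t) = c + t h(t)` one has `c E m R(c E m) = c² E (m + E m² h(c E
  -- m))`, and the bracket is `q(m)`.
  { q            = 0 ∷ 1 ∷ scale E (c ℕ.* E) h
  ; q0≡0         = refl
  ; remainder    = ⟦ 0 ∷ 0 ∷ scale 1 (c ℕ.* E) h ⟧
  ; congruential = ⟦⟧-congruential (0 ∷ 0 ∷ scale 1 (c ℕ.* E) h)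
  ; q≡           = λ m → trans (cong (λ y → 0 + m ℕ.* (1 + m ℕ.* y)) (⟦scale⟧ E (c ℕ.* E) h m))
      (trans (factor m E (⟦ h ⟧ (c ℕ.* E ℕ.* m))) (cong (λ y → m + E ℕ.* (0 + m ℕ.* (0 + m ℕ.* y))) (sym (⟦scale⟧ 1 (c ℕ.* E) h m))))
  ; leading-∣    = λ c∣E → scaledLead-∣ {E} {i = 1} ℓ k
      (ℕ∣.∣-reflexive (sym (ℕ.^-identityʳ E)))
      (subst (c ℕ.* E ∣ℕ_) (cong (E ℕ.*_) (sym (ℕ.^-identityʳ E))) (ℕ∣.*-monoˡ-∣ E c∣E))
  ; q-scaled     = λ m → trans (cong (λ y → c ℕ.* (c ℕ.* E) ℕ.* (0 + m ℕ.* (1 + m ℕ.* y))) (⟦scale⟧ E (c ℕ.* E) h m))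
      (scaled c E m (⟦ h ⟧ (c ℕ.* E ℕ.* m)))
  }
  where
  factor : ∀ m E y → 0 + m ℕ.* (1 + m ℕ.* (E ℕ.* y)) ≡ m + E ℕ.* (0 + m ℕ.* (0 + m ℕ.* (1 ℕ.* y)))
  factor = ℕ-Ring.solve-∀
  scaled : ∀ c E m y → c ℕ.* (c ℕ.* E) ℕ.* (0 + m ℕ.* (1 + m ℕ.* (E ℕ.* y))) ≡ c ℕ.* E ℕ.* m ℕ.* (c + c ℕ.* E ℕ.* m ℕ.* y)
  scaled = ℕ-Ring.solve-∀

-- Hensel lifting and values in a residue class

module Hensel (E′ : ℕ) (q w : ℕ → ℕ) (w-congruential : Congruential w) (q≡ : ∀ m → q m ≡ m + suc E′ ℕ.* w m) where

  private
    E : ℕ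
    E = suc E′

  q-translate : ∀ m x → ∃[ v ] q (m + x) ≡ q m + x ℕ.* (1 + E ℕ.* v)
  q-translate m x with w-congruential m x
  ... | v , eq = v , trans (q≡ (m + x)) (trans (cong (λ y → m + x + E ℕ.* y) eq)
      (trans (expand m x (w m) v E) (cong (_+ x ℕ.* (1 + E ℕ.* v)) (sym (q≡ m)))))
    where
    expand : ∀ m x w v E → m + x + E ℕ.* (w + x ℕ.* v) ≡ m + E ℕ.* w + x ℕ.* (1 + E ℕ.* v)
    expand = ℕ-Ring.solve-∀

  -- The wanted residue is `-z`. If `q (m + t) + z = a E^J`, moving the argument by `x` changes the
  -- value by `x` times a number congruent to 1 modulo `E`. As `E′ ≡ -1` modulo `E`, the choice
  -- `x = E^J a E′` cancels the digit `a` without subtraction.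
  hensel : ∀ J m z → ∃[ t ] E ℕ.^ J ∣ℕ q (m + t) + z
  hensel zero    m z = 0 , ℕ∣.1∣ _
  hensel (suc J) m z with hensel J m z
  ... | t , ℕ∣.divides a eq with q-translate (m + t) (E ℕ.^ J ℕ.* (a ℕ.* E′))
  ...   | v , eq′ = t + x , ℕ∣.divides (a + a ℕ.* E′ ℕ.* v) (begin
      q (m + (t + x)) + z                       ≡⟨ cong (λ y → q y + z) (ℕ.+-assoc m t x) ⟨
      q (m + t + x) + z                         ≡⟨ cong (_+ z) eq′ ⟩
      q (m + t) + x ℕ.* (1 + E ℕ.* v) + z       ≡⟨ swap (q (m + t)) (x ℕ.* (1 + E ℕ.* v)) z ⟩
      q (m + t) + z + x ℕ.* (1 + E ℕ.* v)       ≡⟨ cong (_+ x ℕ.* (1 + E ℕ.* v)) eq ⟩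
      a ℕ.* E ℕ.^ J + x ℕ.* (1 + E ℕ.* v)       ≡⟨ collect a (E ℕ.^ J) E′ v ⟩
      (a + a ℕ.* E′ ℕ.* v) ℕ.* E ℕ.^ suc J      ∎)
    where
    open ≡-Reasoning
    x : ℕ
    x = E ℕ.^ J ℕ.* (a ℕ.* E′)
    swap : ∀ a b c → a + b + c ≡ a + c + b
    swap = ℕ-Ring.solve-∀
    collect : ∀ a T e v → a ℕ.* T + T ℕ.* (a ℕ.* e) ℕ.* (1 + suc e ℕ.* v) ≡ (a + a ℕ.* e ℕ.* v) ℕ.* (suc e ℕ.* T)
    collect = ℕ-Ring.solve-∀

  -- Moving the argument by a multiple of `Γ` changes `q` by a multiple of `Γ`, so the lifted `t`
  -- may be reduced modulo `Γ`.
  hensel-block : ∀ J m z → ∃[ t ] (t ℕ.< E ℕ.^ J × E ℕ.^ J ∣ℕ q (m + t) + z)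
  hensel-block J m z with hensel J m z
  ... | t , Γ∣ = t % Γ , m%n<n t Γ , ℕ∣.∣m+n∣m⇒∣n (subst (Γ ∣ℕ_) reduce Γ∣) (ℕ∣.∣m⇒∣m*n _ (ℕ∣.n∣m*n (t / Γ)))
    where
    Γ : ℕ
    Γ = E ℕ.^ J
    instance
      Γ≢0 : NonZero Γ
      Γ≢0 = ℕ.m^n≢0 E J
    v : ℕ
    v = proj₁ (q-translate (m + t % Γ) (t / Γ ℕ.* Γ))
    swap : ∀ a b c → a + b + c ≡ b + (a + c)
    swap = ℕ-Ring.solve-∀
    reduce : q (m + t) + z ≡ t / Γ ℕ.* Γ ℕ.* (1 + E ℕ.* v) + (q (m + t % Γ) + z)
    reduce = trans (cong (λ y → q y + z) (trans (cong (m ℕ.+_) (m≡m%n+[m/n]*n t Γ)) (sym (ℕ.+-assoc m (t % Γ) (t / Γ ℕ.* Γ)))))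
      (trans (cong (_+ z) (proj₂ (q-translate (m + t % Γ) (t / Γ ℕ.* Γ)))) (swap (q (m + t % Γ)) _ z))

-- The values of p on a block of Γ consecutive arguments starting at the first
-- value ≥ s stay below s + Γ G, and they cover all residues modulo Γ.
module _ {ℓ k} (p : Poly ℓ k) (M Γ′ : ℕ)
  (p0≡0  : ⟦ p ⟧ 0 ≡ 0)
  (1≤G   : 1 ℕ.≤ forward-difference p M)
  (block : ∀ m z → ∃[ t ] (t ℕ.< suc Γ′ × suc Γ′ ∣ℕ ⟦ p ⟧ (m + t) + z))
  (s : ℕ) (fits : s + suc Γ′ ℕ.* forward-difference p M ℕ.≤ ⟦ p ⟧ M) where

  private
    G Γ : ℕ
    G = forward-difference p M
    Γ = suc Γ′

    gap : ∀ {m} → m ℕ.≤ M → ⟦ p ⟧ (suc m) ℕ.≤ ⟦ p ⟧ m + G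
    gap {m} m≤M = ℕ.≤-trans (ℕ.≤-reflexive (⟦⟧-suc p m)) (ℕ.+-monoʳ-≤ (⟦ p ⟧ m) (forward-difference-mono p m≤M))

    first : ∀ m → m ℕ.≤ M → s ℕ.≤ ⟦ p ⟧ m → ∃[ m* ] (s ℕ.≤ ⟦ p ⟧ m* × ⟦ p ⟧ m* ℕ.< s + G)
    first zero    _   s≤ = 0 , s≤ , ℕ.≤-trans (ℕ.≤-trans (s≤s (ℕ.≤-reflexive p0≡0)) 1≤G) (ℕ.m≤n+m G s)
    first (suc m) m<M s≤ with s ℕ.≤? ⟦ p ⟧ m
    ... | yes s≤pm = first m (ℕ.<⇒≤ m<M) s≤pm
    ... | no  s≰pm = suc m , s≤ , ℕ.≤-trans (s≤s (gap (ℕ.<⇒≤ m<M))) (ℕ.+-monoˡ-≤ G (ℕ.≰⇒> s≰pm))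

    below-M : ∀ {m t} → t ℕ.< Γ → ⟦ p ⟧ m ℕ.< s + suc t ℕ.* G → m ℕ.< M
    below-M {m} {t} t<Γ pm< = ℕ.≰⇒> λ M≤m → ℕ.<⇒≱ pm<
      (ℕ.≤-trans (ℕ.+-monoʳ-≤ s (ℕ.*-monoˡ-≤ G t<Γ)) (ℕ.≤-trans fits (⟦⟧-mono p M≤m)))

    climb : ∀ m* → ⟦ p ⟧ m* ℕ.< s + G → ∀ t → t ℕ.< Γ → ⟦ p ⟧ (m* + t) ℕ.< s + suc t ℕ.* G
    climb m* pm*< zero    _   = subst₂ (λ m g → ⟦ p ⟧ m ℕ.< s + g) (sym (ℕ.+-identityʳ m*)) (sym (ℕ.*-identityˡ G)) pm*<
    climb m* pm*< (suc t) t<Γ = begin-strict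
      ⟦ p ⟧ (m* + suc t)          ≡⟨ cong ⟦ p ⟧ (ℕ.+-suc m* t) ⟩
      ⟦ p ⟧ (suc (m* + t))        ≤⟨ gap (ℕ.<⇒≤ (below-M (ℕ.<⇒≤ t<Γ) previous)) ⟩
      ⟦ p ⟧ (m* + t) + G          <⟨ ℕ.+-monoˡ-< G previous ⟩
      s + suc t ℕ.* G + G         ≡⟨ collect s (suc t ℕ.* G) G ⟩
      s + suc (suc t) ℕ.* G       ∎
      where
      open ℕ.≤-Reasoning
      previous : ⟦ p ⟧ (m* + t) ℕ.< s + suc t ℕ.* G
      previous = climb m* pm*< t (ℕ.<⇒≤ t<Γ)
      collect : ∀ s x g → s + x + g ≡ s + (g + x)
      collect = ℕ-Ring.solve-∀

  represent : ∃[ m ] ∃[ r ] (m ℕ.< M × r ℕ.< G × ⟦ p ⟧ m ≡ s + Γ ℕ.* r)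
  represent with first M ℕ.≤-refl (ℕ.≤-trans (ℕ.m≤m+n s (Γ ℕ.* G)) fits)
  -- Modulo `Γ` the number `s Γ′` is `-s`, so the value found is congruent to `s`.
  ... | m* , s≤ , pm*< with block m* (s ℕ.* Γ′)
  ...   | t , t<Γ , Γ∣ = m* + t , from-quotient Γ∣x
    where
    value< : ⟦ p ⟧ (m* + t) ℕ.< s + suc t ℕ.* G
    value< = climb m* pm*< t t<Γ
    x : ℕ
    x = ⟦ p ⟧ (m* + t) ℕ.∸ s
    value≡ : ⟦ p ⟧ (m* + t) ≡ s + x
    value≡ = sym (ℕ.m+[n∸m]≡n (ℕ.≤-trans s≤ (⟦⟧-mono p (ℕ.m≤m+n m* t))))
    Γ∣x : Γ ∣ℕ x
    Γ∣x = ℕ∣.∣m+n∣m⇒∣n (subst (Γ ∣ℕ_) (trans (cong (_+ s ℕ.* Γ′) value≡) (regroup s x Γ′)) Γ∣) (ℕ∣.n∣m*n s)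
      where
      regroup : ∀ s x g → s + x + s ℕ.* g ≡ s ℕ.* suc g + x
      regroup = ℕ-Ring.solve-∀
    from-quotient : Γ ∣ℕ x → ∃[ r ] (m* + t ℕ.< M × r ℕ.< G × ⟦ p ⟧ (m* + t) ≡ s + Γ ℕ.* r)
    from-quotient (ℕ∣.divides r x≡rΓ) = r , below-M t<Γ value< ,
      ℕ.*-cancelˡ-< Γ r G (ℕ.+-cancelˡ-< s (Γ ℕ.* r) (Γ ℕ.* G)
        (ℕ.<-≤-trans (subst (ℕ._< s + suc t ℕ.* G) value≡′ value<) (ℕ.+-monoʳ-≤ s (ℕ.*-monoˡ-≤ G t<Γ)))) ,
      value≡′
      where
      value≡′ : ⟦ p ⟧ (m* + t) ≡ s + Γ ℕ.* r
      value≡′ = trans value≡ (cong (s ℕ.+_) (trans x≡rΓ (ℕ.*-comm r Γ)))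

-- Sums of distinct elements in dense finite sets

-- S is the cardinality of A, so A has density at least 1/K in [0, N].
DenseSumsMeet : ℕ → (ℕ → ℕ) → Set
DenseSumsMeet K q = ∃[ N₀ ] (∀ N S (A : ℕ → Bool) → N₀ ℕ.≤ N → (∀ y → A y ≡ true → y ℕ.≤ N) →
  (∀ W → N ℕ.< W → ∑ W (λ y → bit (A y)) ≡ + S) → N ℕ.≤ K ℕ.* S →
  ∃[ y ] ∃[ z ] ∃[ m ] (A y ≡ true × A z ≡ true × y ≢ z × y + z ≡ q m))

bracket : ∀ {ℓ k} (p : Poly ℓ k) {v} n → ⟦ p ⟧ 0 ℕ.< v → v ℕ.≤ ⟦ p ⟧ n → ∃[ m ] (⟦ p ⟧ m ℕ.< v × v ℕ.≤ ⟦ p ⟧ (suc m))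
bracket p zero    p0<v v≤pn = ⊥-elim (ℕ.<⇒≱ p0<v v≤pn)
bracket p {v} (suc n) p0<v v≤pn with v ℕ.≤? ⟦ p ⟧ n
... | yes v≤pn′ = bracket p n p0<v v≤pn′
... | no  v≰pn  = n , ℕ.≰⇒> v≰pn , v≤pn

-- Bounds `M G / N` in degree `k`: `M G ≤ p(2 M) ≤ 2^k p(M) ≤ 2^k 2^k p(M - 1)`, and `p(M - 1) < 4
-- N`.
growthFactor : ℕ → ℕ
growthFactor k = 2 ℕ.^ k ℕ.* (2 ℕ.^ k ℕ.* 4)

growthFactor≢0 : ∀ k → NonZero (growthFactor k)
growthFactor≢0 k = ℕ.m*n≢0 (2 ℕ.^ k) (2 ℕ.^ k ℕ.* 4) {{ℕ.m^n≢0 2 k}} {{ℕ.m*n≢0 (2 ℕ.^ k) 4 {{ℕ.m^n≢0 2 k}}}}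

module Dense {ℓ k} (p : Poly ℓ (suc k)) (C K κ Γ′ D c μ e : ℕ)
  (C≡ : C ≡ growthFactor (suc k))
  (κ≡ : κ ≡ 2 ℕ.* (C ℕ.* K))
  (K≢0 : NonZero K)
  (p0≡0 : ⟦ p ⟧ 0 ≡ 0)
  (m≤pm : ∀ m → m ℕ.≤ ⟦ p ⟧ m)
  (increasing : ∀ m → 1 ℕ.≤ forward-difference p m)
  (block : ∀ m z → ∃[ t ] (t ℕ.< suc Γ′ × suc Γ′ ∣ℕ ⟦ p ⟧ (m + t) + z))
  (Γ≡ : suc Γ′ ≡ D ℕ.* μ ℕ.* e)
  (leading : HasLeading (suc k) μ ⟦ p ⟧)
  (invariant : AlmostInvariant k (κ ℕ.* κ) D c)
  where

  private
    Γ B T N₀ L : ℕ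
    Γ = suc Γ′
    B = ⟦ p ⟧ 1
    -- The two summands of `T` give `c e G ≤ M^(k + 1)` and `Γ G ≤ N` as soon as `M ≥ T`. In `N₀`,
    -- the value `p(T)` ensures `M > T`, and `K (2 L)` contradicts the final bound `S ≤ 2 L`.
    T = suc (c ℕ.* e ℕ.* C ℕ.* B + Γ ℕ.* C)
    L = C ℕ.* K
    N₀ = suc (⟦ p ⟧ T + K ℕ.* (2 ℕ.* L))

  -- The level `4 N` leaves room for `y + z ≤ 2 N` and for an interval of length `Γ G ≤ N` above it,
  -- so all representations use arguments below `M`.
  module Scale (N M′ : ℕ) (N₀≤N : N₀ ℕ.≤ N) (pM′< : ⟦ p ⟧ M′ ℕ.< 4 ℕ.* N) (≤pM : 4 ℕ.* N ℕ.≤ ⟦ p ⟧ (suc M′)) where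

    open ℕ.≤-Reasoning

    M G : ℕ
    M = suc M′
    G = forward-difference p M

    N≤4N : N ℕ.≤ 4 ℕ.* N
    N≤4N = ℕ.m≤n*m N 4

    T≤M′ : T ℕ.≤ M′
    T≤M′ = ℕ.s≤s⁻¹ (ℕ.≰⇒> λ M≤T → ℕ.<⇒≱
      (ℕ.≤-trans (s≤s (ℕ.m≤m+n (⟦ p ⟧ T) _)) N₀≤N)
      (ℕ.≤-trans N≤4N (ℕ.≤-trans ≤pM (⟦⟧-mono p M≤T))))

    T≤M : T ℕ.≤ M
    T≤M = ℕ.m≤n⇒m≤1+n T≤M′

    pM≤ : ⟦ p ⟧ M ℕ.≤ 2 ℕ.^ suc k ℕ.* (4 ℕ.* N)
    pM≤ = begin
      ⟦ p ⟧ M                          ≤⟨ ⟦⟧-mono p (ℕ.+-monoˡ-≤ M′ (ℕ.≤-trans (s≤s z≤n) T≤M′)) ⟩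
      ⟦ p ⟧ (M′ + M′)                  ≤⟨ ⟦⟧-double p M′ ⟩
      2 ℕ.^ suc k ℕ.* ⟦ p ⟧ M′         ≤⟨ ℕ.*-monoʳ-≤ (2 ℕ.^ suc k) (ℕ.<⇒≤ pM′<) ⟩
      2 ℕ.^ suc k ℕ.* (4 ℕ.* N)        ∎

    MG≤CN : M ℕ.* G ℕ.≤ C ℕ.* N
    MG≤CN = begin
      M ℕ.* G                                            ≤⟨ ⟦⟧-convex p M M ⟩
      ⟦ p ⟧ (M + M)                                      ≤⟨ ⟦⟧-double p M ⟩
      2 ℕ.^ suc k ℕ.* ⟦ p ⟧ M                            ≤⟨ ℕ.*-monoʳ-≤ (2 ℕ.^ suc k) pM≤ ⟩
      2 ℕ.^ suc k ℕ.* (2 ℕ.^ suc k ℕ.* (4 ℕ.* N))        ≡⟨ collect (2 ℕ.^ suc k) N ⟩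
      growthFactor (suc k) ℕ.* N                         ≡⟨ cong (ℕ._* N) C≡ ⟨
      C ℕ.* N                                            ∎
      where
      collect : ∀ t n → t ℕ.* (t ℕ.* (4 ℕ.* n)) ≡ t ℕ.* (t ℕ.* 4) ℕ.* n
      collect = ℕ-Ring.solve-∀

    ΓG≤N : Γ ℕ.* G ℕ.≤ N
    ΓG≤N = ℕ.*-cancelˡ-≤ M (begin
      M ℕ.* (Γ ℕ.* G)        ≡⟨ exchange M Γ G ⟩
      Γ ℕ.* (M ℕ.* G)        ≤⟨ ℕ.*-monoʳ-≤ Γ MG≤CN ⟩
      Γ ℕ.* (C ℕ.* N)        ≡⟨ ℕ.*-assoc Γ C N ⟨
      Γ ℕ.* C ℕ.* N          ≤⟨ ℕ.*-monoˡ-≤ N (ℕ.≤-trans (ℕ.m≤n⇒m≤1+n (ℕ.m≤n+m (Γ ℕ.* C) (c ℕ.* e ℕ.* C ℕ.* B))) T≤M) ⟩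
      M ℕ.* N                ∎)
      where
      exchange : ∀ m g h → m ℕ.* (g ℕ.* h) ≡ g ℕ.* (m ℕ.* h)
      exchange = ℕ-Ring.solve-∀

    ceG≤ : c ℕ.* (e ℕ.* G) ℕ.≤ M ℕ.^ suc k
    ceG≤ = ℕ.*-cancelˡ-≤ M (begin
      M ℕ.* (c ℕ.* (e ℕ.* G))                          ≡⟨ exchange M c e G ⟩
      c ℕ.* e ℕ.* (M ℕ.* G)                            ≤⟨ ℕ.*-monoʳ-≤ (c ℕ.* e) MG≤CN ⟩
      c ℕ.* e ℕ.* (C ℕ.* N)                            ≤⟨ ℕ.*-monoʳ-≤ (c ℕ.* e) (ℕ.*-monoʳ-≤ C (ℕ.≤-trans (ℕ.≤-trans N≤4N ≤pM) (⟦⟧≤⟦⟧1*^ p M))) ⟩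
      c ℕ.* e ℕ.* (C ℕ.* (B ℕ.* M ℕ.^ suc k))          ≡⟨ collect (c ℕ.* e) C B (M ℕ.^ suc k) ⟩
      c ℕ.* e ℕ.* C ℕ.* B ℕ.* M ℕ.^ suc k              ≤⟨ ℕ.*-monoˡ-≤ (M ℕ.^ suc k) (ℕ.≤-trans (ℕ.m≤n⇒m≤1+n (ℕ.m≤m+n (c ℕ.* e ℕ.* C ℕ.* B) (Γ ℕ.* C))) T≤M) ⟩
      M ℕ.* M ℕ.^ suc k                                ∎)
      where
      exchange : ∀ m c e g → m ℕ.* (c ℕ.* (e ℕ.* g)) ≡ c ℕ.* e ℕ.* (m ℕ.* g)
      exchange = ℕ-Ring.solve-∀
      collect : ∀ x c b t → x ℕ.* (c ℕ.* (b ℕ.* t)) ≡ x ℕ.* c ℕ.* b ℕ.* t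
      collect = ℕ-Ring.solve-∀

    module _ (S : ℕ) (A : ℕ → Bool) (support : ∀ y → A y ≡ true → y ℕ.≤ N)
      (size : ∀ W → N ℕ.< W → ∑ W (λ y → bit (A y)) ≡ + S) (N≤KS : N ℕ.≤ K ℕ.* S)
      (no-solution : ∀ y z m → A y ≡ true → A z ≡ true → m ℕ.< M → y + z ≡ ⟦ p ⟧ m → y ≡ z) where

      W′ : ℕ
      W′ = suc N + suc N + ⟦ p ⟧ M

      invariant-Γ : ∀ r → r ℕ.< G → ∀ {f} → Periodic (suc W′) f →
        + κ ℤ.* + κ ℤ.* norm² (suc W′) (orbitSum ⟦ p ⟧ M (difference (Γ ℕ.* r) f)) ℤ.≤ + M ℤ.* (+ M ℤ.* norm² (suc W′) f)
      invariant-Γ r r<G {f} per = subst₂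
        (λ κ² d → κ² ℤ.* norm² (suc W′) (orbitSum ⟦ p ⟧ M (difference d f)) ℤ.≤ + M ℤ.* (+ M ℤ.* norm² (suc W′) f))
        (ℤ.pos-* κ κ) (trans (sym (ℕ.*-assoc (D ℕ.* μ) e r)) (cong (ℕ._* r) (sym Γ≡)))
        (invariant per leading M′ (e ℕ.* r) (ℕ.≤-trans (ℕ.*-monoʳ-≤ c (ℕ.*-monoʳ-≤ e (ℕ.<⇒≤ r<G))) ceG≤))

      represent-A : ∀ y z → A y ≡ true → A z ≡ true → ∃[ m ] ∃[ r ] (m ℕ.< M × r ℕ.< G × ⟦ p ⟧ m ≡ y + z + Γ ℕ.* r)
      represent-A y z Ay Az = represent p M Γ′ p0≡0 (increasing M) block (y + z) (begin
        y + z + Γ ℕ.* G        ≤⟨ ℕ.+-mono-≤ (ℕ.+-mono-≤ (support y Ay) (support z Az)) ΓG≤N ⟩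
        N + N + N              ≤⟨ ℕ.m≤m+n (N + N + N) N ⟩
        N + N + N + N          ≡⟨ four N ⟩
        4 ℕ.* N                ≤⟨ ≤pM ⟩
        ⟦ p ⟧ M                ∎)
        where
        four : ∀ n → n + n + n + n ≡ 4 ℕ.* n
        four = ℕ-Ring.solve-∀

      κS²≤ : κ ℕ.* (S ℕ.* S) ℕ.≤ G ℕ.* (M ℕ.* (κ + S))
      κS²≤ = ℤ.drop‿+≤+ (subst₂ ℤ._≤_ left right (subst (λ s → + κ ℤ.* (s ℤ.* s) ℤ.≤ + G ℤ.* (+ M ℤ.* (+ κ ℤ.+ s)))
        (size (suc W′) (s≤s (ℕ.≤-trans (ℕ.n≤1+n N) (ℕ.≤-trans (ℕ.m≤m+n (suc N) (suc N)) (ℕ.m≤m+n (suc N + suc N) (⟦ p ⟧ M))))))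
        (Counting.S²-bound ⟦ p ⟧ M′ W′ (suc N) Γ G κ A
          (λ y Ay → s≤s (support y Ay))
          (ℕ.m≤n⇒m≤1+n (ℕ.m≤m+n (suc N + suc N) (⟦ p ⟧ M)))
          (λ m m<M → s≤s (ℕ.≤-trans (⟦⟧-mono p (ℕ.<⇒≤ m<M)) (ℕ.m≤n+m (⟦ p ⟧ M) (suc N + suc N))))
          invariant-Γ represent-A no-solution)))
        where
        left : + κ ℤ.* (+ S ℤ.* + S) ≡ + (κ ℕ.* (S ℕ.* S))
        left = trans (cong (+ κ ℤ.*_) (sym (ℤ.pos-* S S))) (sym (ℤ.pos-* κ (S ℕ.* S)))
        right : + G ℤ.* (+ M ℤ.* + (κ + S)) ≡ + (G ℕ.* (M ℕ.* (κ + S)))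
        right = trans (cong (+ G ℤ.*_) (sym (ℤ.pos-* M (κ + S)))) (sym (ℤ.pos-* G (M ℕ.* (κ + S))))

      S≢0 : NonZero S
      S≢0 = ℕ.≢-nonZero λ { refl → ℕ.<⇒≱ (ℕ.≤-trans (s≤s z≤n) N₀≤N) (ℕ.≤-trans N≤KS (ℕ.≤-reflexive (ℕ.*-zeroʳ K))) }

      -- From `G M ≤ C N ≤ L S` one gets `2 L S² ≤ L S (2 L + S)`. Taking `κ` to be `2 L` rather
      -- than `L` lets half of the left side absorb `L S²`.
      S≤2L : S ℕ.≤ 2 ℕ.* L
      S≤2L = ℕ.+-cancelʳ-≤ S S (2 ℕ.* L) (ℕ.*-cancelˡ-≤ (L ℕ.* S) {{LS≢0}} (begin
        L ℕ.* S ℕ.* (S + S)                      ≡⟨ double L S ⟩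
        2 ℕ.* L ℕ.* (S ℕ.* S)                    ≡⟨ cong (ℕ._* (S ℕ.* S)) κ≡ ⟨
        κ ℕ.* (S ℕ.* S)                          ≤⟨ κS²≤ ⟩
        G ℕ.* (M ℕ.* (κ + S))                    ≡⟨ regroup G M (κ + S) ⟩
        M ℕ.* G ℕ.* (κ + S)                      ≤⟨ ℕ.*-monoˡ-≤ (κ + S) (ℕ.≤-trans MG≤CN (ℕ.*-monoʳ-≤ C N≤KS)) ⟩
        C ℕ.* (K ℕ.* S) ℕ.* (κ + S)              ≡⟨ cong₂ (λ x y → x ℕ.* (y + S)) (sym (ℕ.*-assoc C K S)) κ≡ ⟩
        L ℕ.* S ℕ.* (2 ℕ.* L + S)                ∎))
        where
        LS≢0 : NonZero (L ℕ.* S)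
        LS≢0 = ℕ.m*n≢0 L S {{ℕ.m*n≢0 C K {{subst NonZero (sym C≡) (growthFactor≢0 (suc k))}} {{K≢0}}}} {{S≢0}}
        double : ∀ l s → l ℕ.* s ℕ.* (s + s) ≡ 2 ℕ.* l ℕ.* (s ℕ.* s)
        double = ℕ-Ring.solve-∀
        regroup : ∀ g m s → g ℕ.* (m ℕ.* s) ≡ m ℕ.* g ℕ.* s
        regroup = ℕ-Ring.solve-∀

      impossible : ⊥
      impossible = ℕ.<⇒≱ N₀≤N (begin
        N                                  ≤⟨ N≤KS ⟩
        K ℕ.* S                            ≤⟨ ℕ.*-monoʳ-≤ K S≤2L ⟩
        K ℕ.* (2 ℕ.* L)                    ≤⟨ ℕ.m≤n+m (K ℕ.* (2 ℕ.* L)) (⟦ p ⟧ T) ⟩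
        ⟦ p ⟧ T + K ℕ.* (2 ℕ.* L)          ∎)

  dense⇒sum-value : DenseSumsMeet K ⟦ p ⟧
  dense⇒sum-value = N₀ , solve
    where
    solve : ∀ N S A → N₀ ℕ.≤ N → (∀ y → A y ≡ true → y ℕ.≤ N) → (∀ W → N ℕ.< W → ∑ W (λ y → bit (A y)) ≡ + S) →
      N ℕ.≤ K ℕ.* S → ∃[ y ] ∃[ z ] ∃[ m ] (A y ≡ true × A z ≡ true × y ≢ z × y + z ≡ ⟦ p ⟧ m)
    solve N S A N₀≤N support size N≤KS
      with bracket p {4 ℕ.* N} (4 ℕ.* N) (subst (ℕ._< 4 ℕ.* N) (sym p0≡0) (ℕ.≤-trans (ℕ.≤-trans (s≤s z≤n) N₀≤N) (ℕ.m≤n*m N 4))) (m≤pm (4 ℕ.* N))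
    ... | M′ , pM′< , ≤pM
      -- A bounded decidable search turns the argument by contradiction into a witness.
      with ℕ.anyUpTo? (λ y → ℕ.anyUpTo? (λ z → ℕ.anyUpTo? (λ m →
             (A y Bool.≟ true) ×-dec (A z Bool.≟ true) ×-dec ¬? (y ℕ.≟ z) ×-dec (y + z ℕ.≟ ⟦ p ⟧ m)) (suc M′)) (suc N)) (suc N)
    ...   | yes (y , _ , z , _ , m , _ , solution) = y , z , m , solution
    ...   | no  none = ⊥-elim (Scale.impossible N M′ N₀≤N pM′< ≤pM S A support size N≤KS no-solution)
      where
      no-solution : ∀ y z m → A y ≡ true → A z ≡ true → m ℕ.< suc M′ → y + z ≡ ⟦ p ⟧ m → y ≡ z
      no-solution y z m Ay Az m<M eq with y ℕ.≟ z
      ... | yes y≡z = y≡z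
      ... | no  y≢z = ⊥-elim (none (y , s≤s (support y Ay) , z , s≤s (support z Az) , m , m<M , Ay , Az , y≢z , eq))

normalised-dense-sums : ∀ {ℓ k} (R : Poly ℓ k) K → NonZero ℓ → NonZero (constantTerm R) → NonZero K →
  ∃[ E ] (NonZero E × DenseSumsMeet K ⟦ Normalisation.q (normalise R E) ⟧)
normalised-dense-sums {ℓ} {k} R K ℓ≢0 c≢0 K≢0 =
  choose (growthFactor (suc k)) (2 ℕ.* (growthFactor (suc k) ℕ.* K)) refl refl (almostInvariant k)
  where
  choose : ∀ C κ → C ≡ growthFactor (suc k) → κ ≡ 2 ℕ.* (C ℕ.* K) →
    (∀ κ → ∃[ D ] ∃[ c ] (NonZero D × AlmostInvariant k κ D c)) →
    ∃[ E ] (NonZero E × DenseSumsMeet K ⟦ Normalisation.q (normalise R E) ⟧)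
  choose C κ C≡ κ≡ almost = from-invariant (almost (κ ℕ.* κ))
    where
    from-invariant : ∃[ D ] ∃[ c ] (NonZero D × AlmostInvariant k (κ ℕ.* κ) D c) →
      ∃[ E ] (NonZero E × DenseSumsMeet K ⟦ Normalisation.q (normalise R E) ⟧)
    from-invariant (D , c , D≢0 , invariant) = E , _ ,
      Dense.dense⇒sum-value q C K κ Γ′ D c μ (ℕ∣.quotient μ∣Γ) C≡ κ≡ K≢0 q0≡0 m≤qm increasing block Γ≡ (hasLeading-⟦⟧ q) invariant
      where
      E₀ E′ E : ℕ
      -- The factor `c` makes `leading-∣` applicable. The factor `D (k + 1)! ℓ` supplies the last
      -- power of `E`: `D μ` divides `D (k + 1)! E^j ℓ`, hence `E^(j + 1) = Γ`.
      E₀ = D ℕ.* suc k ! ℕ.* (constantTerm R ℕ.* ℓ)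
      E′ = ℕ.pred E₀
      E  = suc E′
      E≡E₀ : E ≡ E₀
      E≡E₀ = ℕ.suc-pred E₀ {{ℕ.m*n≢0 (D ℕ.* suc k !) (constantTerm R ℕ.* ℓ) {{ℕ.m*n≢0 D (suc k !) {{D≢0}} {{suc k ℕ.!≢0}}}} {{ℕ.m*n≢0 (constantTerm R) ℓ {{c≢0}} {{ℓ≢0}}}}}}
      open Normalisation (normalise R E) renaming (remainder to w; leading to ℓ′)
      c∣E : constantTerm R ∣ℕ E
      c∣E = subst (constantTerm R ∣ℕ_) (sym E≡E₀) (ℕ∣.∣n⇒∣m*n (D ℕ.* suc k !) (ℕ∣.m∣m*n ℓ))
      j Γ′ μ : ℕ
      j  = proj₁ (leading-∣ c∣E)
      Γ′ = ℕ.pred (E ℕ.^ suc j)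
      μ  = suc k ! ℕ.* ℓ′
      Γ≡E^ : suc Γ′ ≡ E ℕ.^ suc j
      Γ≡E^ = ℕ.suc-pred (E ℕ.^ suc j) {{ℕ.m^n≢0 E (suc j)}}
      μ∣Γ : D ℕ.* μ ∣ℕ suc Γ′
      μ∣Γ = subst₂ _∣ℕ_ (ℕ.*-assoc D (suc k !) ℓ′) (trans (ℕ.*-comm (E ℕ.^ j) E) (sym Γ≡E^))
        (ℕ∣.∣-trans (ℕ∣.*-monoʳ-∣ (D ℕ.* suc k !) (proj₂ (leading-∣ c∣E)))
          (subst (_∣ℕ E ℕ.^ j ℕ.* E) (exchange (E ℕ.^ j) (D ℕ.* suc k !) ℓ) (ℕ∣.*-monoʳ-∣ (E ℕ.^ j) Dk!ℓ∣E)))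
        where
        exchange : ∀ e x l → e ℕ.* (x ℕ.* l) ≡ x ℕ.* (e ℕ.* l)
        exchange = ℕ-Ring.solve-∀
        Dk!ℓ∣E : D ℕ.* suc k ! ℕ.* ℓ ∣ℕ E
        Dk!ℓ∣E = subst (D ℕ.* suc k ! ℕ.* ℓ ∣ℕ_) (sym E≡E₀) (ℕ∣.*-monoʳ-∣ (D ℕ.* suc k !) (ℕ∣.n∣m*n (constantTerm R)))
      Γ≡ : suc Γ′ ≡ D ℕ.* μ ℕ.* ℕ∣.quotient μ∣Γ
      Γ≡ = trans (ℕ∣._∣_.equality μ∣Γ) (ℕ.*-comm (ℕ∣.quotient μ∣Γ) (D ℕ.* μ))
      open Hensel E′ ⟦ q ⟧ w congruential q≡
      block : ∀ m z → ∃[ t ] (t ℕ.< suc Γ′ × suc Γ′ ∣ℕ ⟦ q ⟧ (m + t) + z)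
      block m z = subst (λ Γ → ∃[ t ] (t ℕ.< Γ × Γ ∣ℕ ⟦ q ⟧ (m + t) + z)) (sym Γ≡E^) (hensel-block (suc j) m z)
      m≤qm : ∀ m → m ℕ.≤ ⟦ q ⟧ m
      m≤qm m = ℕ.≤-trans (ℕ.m≤m+n m (E ℕ.* w m)) (ℕ.≤-reflexive (sym (q≡ m)))
      increasing : ∀ m → 1 ℕ.≤ forward-difference q m
      increasing m = ℕ.+-cancelˡ-≤ (⟦ q ⟧ m) 1 (forward-difference q m) (ℕ.≤-trans
        (ℕ.+-monoʳ-≤ (⟦ q ⟧ m) (ℕ.≤-trans (s≤s z≤n) (ℕ.m≤m+n _ 0)))
        (ℕ.≤-reflexive (trans (sym (proj₂ (q-translate m 1))) (trans (cong ⟦ q ⟧ (ℕ.+-comm m 1)) (⟦⟧-suc q m)))))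

-- Expansion at a large argument with even value

-- The quotient of `(n + t) p(t) - n p(0)` by `t`: one Horner step of a Taylor shift by `n`.
linearShift : ∀ {ℓ k} → ℕ → Poly ℓ k → Poly ℓ k
linearShift n lead    = lead
linearShift n (a ∷ p) = a + n ℕ.* constantTerm p ∷ linearShift n p

⟦linearShift⟧ : ∀ {ℓ k} n (p : Poly ℓ k) t → n ℕ.* constantTerm p + t ℕ.* ⟦ linearShift n p ⟧ t ≡ (n + t) ℕ.* ⟦ p ⟧ t
⟦linearShift⟧ {ℓ} n lead t = sym (ℕ.*-distribʳ-+ ℓ n t)
⟦linearShift⟧ n (a ∷ p)  t = begin
  n ℕ.* a + t ℕ.* (a + n ℕ.* constantTerm p + t ℕ.* ⟦ linearShift n p ⟧ t)   ≡⟨ cong (λ y → n ℕ.* a + t ℕ.* y) (ℕ.+-assoc a (n ℕ.* constantTerm p) _) ⟩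
  n ℕ.* a + t ℕ.* (a + (n ℕ.* constantTerm p + t ℕ.* ⟦ linearShift n p ⟧ t)) ≡⟨ cong (λ y → n ℕ.* a + t ℕ.* (a + y)) (⟦linearShift⟧ n p t) ⟩
  n ℕ.* a + t ℕ.* (a + (n + t) ℕ.* ⟦ p ⟧ t)                                  ≡⟨ collect n a t (⟦ p ⟧ t) ⟩
  (n + t) ℕ.* (a + t ℕ.* ⟦ p ⟧ t)                                            ∎
  where
  open ≡-Reasoning
  collect : ∀ n a t r → n ℕ.* a + t ℕ.* (a + (n + t) ℕ.* r) ≡ (n + t) ℕ.* (a + t ℕ.* r)
  collect = ℕ-Ring.solve-∀

constantTerm-linearShift : ∀ {ℓ k} n (p : Poly ℓ k) → constantTerm p ℕ.≤ constantTerm (linearShift n p)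
constantTerm-linearShift n lead    = ℕ.≤-refl
constantTerm-linearShift n (a ∷ p) = ℕ.m≤m+n a _

-- The list may end in zeros, so the leading coefficient is marked by a remainder that vanishes as a
-- function; `k` is the true degree.
data HasPositiveLead : ℤ[x] → ℕ → ℕ → Set where
  constant : ∀ {n p} → (∀ x → eval p x ≡ 0ℤ) → HasPositiveLead (+ suc n ∷ p) (suc n) 0
  cons     : ∀ {a p ℓ k} → HasPositiveLead p ℓ k → HasPositiveLead (a ∷ p) ℓ (suc k)

positiveLead⇒NonZero : ∀ {p ℓ k} → HasPositiveLead p ℓ k → NonZero ℓ
positiveLead⇒NonZero (constant _) = _
positiveLead⇒NonZero (cons pos)   = positiveLead⇒NonZero pos

EventuallyNegative : (ℤ → ℤ) → Set
EventuallyNegative f = ∃[ X ] (∀ n → X ℕ.≤ n → f (+ n) ℤ.≤ ℤ.-1ℤ)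

i≤+∣i∣ : ∀ i → i ℤ.≤ + ℤ.∣ i ∣
i≤+∣i∣ (+ n)      = ℤ.≤-refl
i≤+∣i∣ ℤ.-[1+ n ] = ℤ.-≤+

eval-zero-tail : ∀ a {p} x → eval p x ≡ 0ℤ → eval (a ∷ p) x ≡ a
eval-zero-tail a x eq = trans (cong (λ t → a ℤ.+ x ℤ.* t) eq) (trans (cong (λ t → a ℤ.+ t) (ℤ.*-zeroʳ x)) (ℤ.+-identityʳ a))

-- Trichotomy by the sign of the leading coefficient. In the negative case a tail that is at most
-- `-1` outweighs `a` for `x` above the absolute value of `a`.
sign-of-lead : ∀ p → (∀ x → eval p x ≡ 0ℤ) ⊎ (∃[ ℓ ] ∃[ k ] HasPositiveLead p ℓ k) ⊎ EventuallyNegative (eval p)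
sign-of-lead [] = inj₁ λ _ → refl
sign-of-lead (a ∷ p) with sign-of-lead p
... | inj₂ (inj₁ (ℓ , k , pos)) = inj₂ (inj₁ (ℓ , suc k , cons pos))
sign-of-lead (+ zero ∷ p)     | inj₁ p≡0 = inj₁ λ x → eval-zero-tail (+ 0) {p} x (p≡0 x)
sign-of-lead (+ suc n ∷ p)    | inj₁ p≡0 = inj₂ (inj₁ (suc n , 0 , constant p≡0))
sign-of-lead (ℤ.-[1+ n ] ∷ p) | inj₁ p≡0 = inj₂ (inj₂ (0 , λ x _ →
  ℤ.≤-trans (ℤ.≤-reflexive (eval-zero-tail ℤ.-[1+ n ] {p} (+ x) (p≡0 (+ x)))) (ℤ.-≤- z≤n)))
sign-of-lead (a ∷ p)          | inj₂ (inj₂ (X , p<0)) = inj₂ (inj₂ (X + suc ℤ.∣ a ∣ , λ x X′≤x → begin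
  a ℤ.+ + x ℤ.* eval p (+ x)          ≤⟨ ℤ.+-mono-≤ (i≤+∣i∣ a) (*-monoˡ-≤-ℕ x (p<0 x (ℕ.≤-trans (ℕ.m≤m+n X _) X′≤x))) ⟩
  + ℤ.∣ a ∣ ℤ.+ + x ℤ.* ℤ.-1ℤ         ≡⟨ negate (+ ℤ.∣ a ∣) (+ x) ⟩
  + ℤ.∣ a ∣ ℤ.- + x                   ≤⟨ ℤ.+-monoʳ-≤ (+ ℤ.∣ a ∣) (ℤ.neg-mono-≤ (ℤ.+≤+ (ℕ.≤-trans (ℕ.m≤n+m (suc ℤ.∣ a ∣) X) X′≤x))) ⟩
  + ℤ.∣ a ∣ ℤ.- (1ℤ ℤ.+ + ℤ.∣ a ∣)    ≡⟨ cancel (+ ℤ.∣ a ∣) ⟩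
  ℤ.-1ℤ                               ∎))
  where
  open ℤ.≤-Reasoning
  negate : ∀ a x → a ℤ.+ x ℤ.* ℤ.-1ℤ ≡ a ℤ.- x
  negate = solve-∀
  cancel : ∀ a → a ℤ.- (1ℤ ℤ.+ a) ≡ ℤ.-1ℤ
  cancel = solve-∀

tendsTo+∞⇒positiveLead : ∀ p → TendsTo+∞ (eval p) →
  ∃[ a ] ∃[ p′ ] ∃[ ℓ ] ∃[ k ] (p ≡ a ∷ p′ × HasPositiveLead p′ ℓ k)
tendsTo+∞⇒positiveLead p tends with sign-of-lead p
... | inj₁ p≡0 with tends 1ℤ
...   | X , big with ℤ.≤-trans (big X ℤ.≤-refl) (ℤ.≤-reflexive (p≡0 X))
...     | ℤ.+≤+ ()
tendsTo+∞⇒positiveLead p tends | inj₂ (inj₂ (Y , p<0)) with tends 0ℤ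
... | X , big with ℤ.≤-trans (big (+ (ℤ.∣ X ∣ + Y)) (ℤ.≤-trans (i≤+∣i∣ X) (ℤ.+≤+ (ℕ.m≤m+n ℤ.∣ X ∣ Y)))) (p<0 (ℤ.∣ X ∣ + Y) (ℕ.m≤n+m Y ℤ.∣ X ∣))
...   | ()
tendsTo+∞⇒positiveLead _ tends | inj₂ (inj₁ (ℓ , suc k , cons {a} {p′} pos)) = a , p′ , ℓ , k , refl , pos
tendsTo+∞⇒positiveLead _ tends | inj₂ (inj₁ (_ , _ , constant {n} {p′} p′≡0)) with tends (+ suc (suc n))
... | X , big with ℤ.≤-trans (big X ℤ.≤-refl) (ℤ.≤-reflexive (eval-zero-tail (+ suc n) {p′} X (p′≡0 X)))
...   | ℤ.+≤+ le = ⊥-elim (ℕ.<⇒≱ ℕ.≤-refl le)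

eval-congruential : ∀ p x y → ∃[ v ] eval p (x ℤ.+ y) ≡ eval p x ℤ.+ y ℤ.* v
eval-congruential [] x y = 0ℤ , sym (trans (ℤ.+-identityˡ _) (ℤ.*-zeroʳ y))
eval-congruential (a ∷ p) x y with eval-congruential p x y
... | v , eq = eval p x ℤ.+ (x ℤ.+ y) ℤ.* v ,
  trans (cong (λ t → a ℤ.+ (x ℤ.+ y) ℤ.* t) eq) (expand a x y (eval p x) v)
  where
  expand : ∀ a x y r v → a ℤ.+ (x ℤ.+ y) ℤ.* (r ℤ.+ y ℤ.* v) ≡ a ℤ.+ x ℤ.* r ℤ.+ y ℤ.* (r ℤ.+ (x ℤ.+ y) ℤ.* v)
  expand = solve-∀

even-translate : ∀ p x j → + 2 ∣ eval p x → + 2 ∣ eval p (x ℤ.+ + 2 ℤ.* j)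
even-translate p x j even with Signed.∣ᵤ⇒∣ {+ 2} {eval p x} even | eval-congruential p x (+ 2 ℤ.* j)
... | Signed.divides i i≡ | v , eq = Signed.∣⇒∣ᵤ {+ 2} {eval p (x ℤ.+ + 2 ℤ.* j)} (Signed.divides (i ℤ.+ j ℤ.* v)
  (trans eq (trans (cong (ℤ._+ + 2 ℤ.* j ℤ.* v) i≡) (collect i j v))))
  where
  collect : ∀ i j v → i ℤ.* + 2 ℤ.+ + 2 ℤ.* j ℤ.* v ≡ (i ℤ.+ j ℤ.* v) ℤ.* + 2
  collect = solve-∀

-- The new constant term `a + n q(0)` is positive because `q(0) ≥ 1` and `n` exceeds the absolute
-- value of `a`. Large `n` thus keeps all coefficients natural.
taylor-cons : ∀ a p {ℓ k} n (q : Poly ℓ k) → suc ℤ.∣ a ∣ ℕ.≤ n → 1 ℕ.≤ constantTerm q →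
  (∀ t → eval p (+ (n + t)) ≡ + ⟦ q ⟧ t) →
  ∃[ b ] (1 ℕ.≤ b × (∀ t → eval (a ∷ p) (+ (n + t)) ≡ + (b + t ℕ.* ⟦ linearShift n q ⟧ t)))
taylor-cons a p n q a<n 1≤q q≡ = b , ℤ.drop‿+≤+ (subst (1ℤ ℤ.≤_) (sym b≡) 1≤sum) , λ t → begin
  a ℤ.+ + (n + t) ℤ.* eval p (+ (n + t))                 ≡⟨ cong (λ y → a ℤ.+ + (n + t) ℤ.* y) (q≡ t) ⟩
  a ℤ.+ + (n + t) ℤ.* + ⟦ q ⟧ t                          ≡⟨ cong (λ y → a ℤ.+ y) (ℤ.pos-* (n + t) (⟦ q ⟧ t)) ⟨
  a ℤ.+ + ((n + t) ℕ.* ⟦ q ⟧ t)                          ≡⟨ cong (λ y → a ℤ.+ + y) (⟦linearShift⟧ n q t) ⟨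
  a ℤ.+ + (n ℕ.* constantTerm q + rest t)                ≡⟨ ℤ.+-assoc a _ _ ⟨
  a ℤ.+ + (n ℕ.* constantTerm q) ℤ.+ + rest t            ≡⟨ cong (ℤ._+ + rest t) b≡ ⟨
  + (b + rest t)                                         ∎
  where
  open ≡-Reasoning
  rest : ℕ → ℕ
  rest t = t ℕ.* ⟦ linearShift n q ⟧ t
  b : ℕ
  b = ℤ.∣ a ℤ.+ + (n ℕ.* constantTerm q) ∣
  -∣i∣≤i : ∀ i → ℤ.- + ℤ.∣ i ∣ ℤ.≤ i
  -∣i∣≤i (+ zero)   = ℤ.≤-refl
  -∣i∣≤i (+ suc _)  = ℤ.-≤+
  -∣i∣≤i ℤ.-[1+ _ ] = ℤ.≤-refl
  cancel : ∀ y → ℤ.- y ℤ.+ (1ℤ ℤ.+ y) ≡ 1ℤ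
  cancel = solve-∀
  1≤sum : 1ℤ ℤ.≤ a ℤ.+ + (n ℕ.* constantTerm q)
  1≤sum = ℤ.≤-trans (ℤ.≤-reflexive (sym (cancel (+ ℤ.∣ a ∣)))) (ℤ.+-mono-≤ (-∣i∣≤i a)
    (ℤ.+≤+ (ℕ.≤-trans a<n (ℕ.m≤m*n n (constantTerm q) {{ℕ.>-nonZero 1≤q}}))))
  b≡ : + b ≡ a ℤ.+ + (n ℕ.* constantTerm q)
  b≡ = ℤ.0≤i⇒+∣i∣≡i (ℤ.≤-trans (ℤ.+≤+ z≤n) 1≤sum)

taylor : ∀ {p ℓ k} → HasPositiveLead p ℓ k → ∃[ n₁ ] (∀ n → n₁ ℕ.≤ n →
  ∃[ q ] (1 ℕ.≤ constantTerm {ℓ} {k} q × (∀ t → eval p (+ (n + t)) ≡ + ⟦ q ⟧ t)))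
taylor (constant {n} {p} p≡0) = 0 , λ m _ → lead , s≤s z≤n , λ t → eval-zero-tail (+ suc n) {p} (+ (m + t)) (p≡0 (+ (m + t)))
taylor (cons {a} {p} pos) with taylor pos
... | n₁ , expand = n₁ + suc ℤ.∣ a ∣ , expand-cons
  where
  expand-cons : ∀ n → n₁ + suc ℤ.∣ a ∣ ℕ.≤ n → _
  expand-cons n n₁′≤n with expand n (ℕ.≤-trans (ℕ.m≤m+n n₁ _) n₁′≤n)
  ... | q , 1≤q , q≡ with taylor-cons a p n q (ℕ.≤-trans (ℕ.m≤n+m (suc ℤ.∣ a ∣) n₁) n₁′≤n) 1≤q q≡
  ...   | b , 1≤b , b≡ = b ∷ linearShift n q , 1≤b , b≡

-- From upper density to dense finite sets

member : ∀ {n} → Subset n → ℕ → Bool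
member []      j       = false
member (s ∷ U) zero    = s
member (s ∷ U) (suc j) = member U j

member⇒∈ : ∀ {n} (U : Subset n) j → member U j ≡ true → ∃[ i ] (i Subset.∈ U × j ≡ toℕ i)
member⇒∈ (s ∷ U) zero    refl = zero , here , refl
member⇒∈ (s ∷ U) (suc j) mem with member⇒∈ U j mem
... | i , i∈U , j≡ = suc i , there i∈U , cong suc j≡

member-< : ∀ {n} (U : Subset n) j → member U j ≡ true → j ℕ.< n
member-< (s ∷ U) zero    mem = s≤s z≤n
member-< (s ∷ U) (suc j) mem = s≤s (member-< U j mem)

∑-member : ∀ {n} (U : Subset n) {W} → n ℕ.≤ W → ∑ W (λ j → bit (member U j)) ≡ + Subset.∣ U ∣
∑-member []          {W} _ = trans (∑-const W 0ℤ) (ℤ.*-zeroʳ (+ W))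
∑-member (false ∷ U) {suc W} (s≤s n≤W) = trans (∑-suc W (λ j → bit (member (false ∷ U) j)))
  (trans (ℤ.+-identityˡ _) (∑-member U n≤W))
∑-member (true ∷ U)  {suc W} (s≤s n≤W) = trans (∑-suc W (λ j → bit (member (true ∷ U) j)))
  (cong (λ t → 1ℤ ℤ.+ t) (∑-member U n≤W))

open ExtReal

<-fraction : ∀ {r : ℚ} S k → r ℚ.< + S ℚ./ suc k → ℚ.↥ r ℤ.* + suc k ℤ.< + S ℤ.* ℚ.↧ r
<-fraction {mkℚ _ _ _} S k r< = ℚᵘ.drop-*<* (ℚᵘ.<-respʳ-≃ (ℚ.toℚᵘ-fromℚᵘ (mkℚᵘ (+ S) k)) (ℚ.toℚᵘ-mono-< r<))

-- The hypothesis only yields a nonnegative rational in the cut; openness of the cut yields a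
-- larger, hence positive, one.
positive-below : ∀ (δ : ℝ) → 0ᵉ <ᵉ ext δ → ∃[ q ] (q ∈ Lower (ext δ) × 1ℤ ℤ.≤ ℚ.↥ q)
positive-below δ (q₀ , q₀≮0 , q₀∈) with rounded (ext δ) q₀∈
... | q₁ , q₀<q₁ , q₁∈ = q₁ , q₁∈ , numerator>0 (ℚ.≤-<-trans (ℚ.≮⇒≥ q₀≮0) q₀<q₁)
  where
  numerator>0 : ∀ {q} → ℚ.0ℚ ℚ.< q → 1ℤ ℤ.≤ ℚ.↥ q
  numerator>0 {mkℚ (+ suc n) _ _}      _            = ℤ.+≤+ (s≤s z≤n)
  numerator>0 {mkℚ (+ zero) _ _}       (ℚ.*<* (ℤ.+<+ ()))
  numerator>0 {mkℚ ℤ.-[1+ n ] _ _}     (ℚ.*<* ())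

DenseInProgression : ℕ → Pred ℕ 0ℓ → (b d : ℕ) → Set
DenseInProgression K A b d = ∀ N₀ → ∃[ k ] (N₀ ℕ.≤ k × ∃[ U ]
  ((∀ {i} → i Subset.∈ U → b + suc (toℕ i) ℕ.* d ∈ A) × suc k ℕ.≤ K ℕ.* Subset.∣_∣ {suc k} U))

-- `K` is the denominator of a positive rational below `δ`, which is therefore at least `1 / K`. It
-- depends on `δ` alone, so `b` and `d` can be chosen before `A`.
upperDensity⇒dense : ∀ (δ : ℝ) → 0ᵉ <ᵉ ext δ →
  ∃[ K ] (NonZero K × (∀ A b d → ext δ <ᵉ upperDensity b d A → DenseInProgression K A b d))
upperDensity⇒dense δ 0<δ with positive-below δ 0<δ
... | q₁ , q₁∈ , 1≤↥q₁ = ℚ.↧ₙ q₁ , _ , large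
  where
  large : ∀ A b d → ext δ <ᵉ upperDensity b d A → DenseInProgression (ℚ.↧ₙ q₁) A b d
  large A b d (q , q∉ , r , q<r , r∈) N₀ with r∈ N₀
  ... | (k , N₀≤k) , (U , U⊆A) , r<∣U∣/k = k , N₀≤k , U , U⊆A ,
    ℤ.drop‿+≤+ (subst₂ ℤ._≤_ (ℤ.*-identityˡ (+ suc k)) (trans (ℤ.*-comm (+ Subset.∣ U ∣) (ℚ.↧ q₁)) (sym (ℤ.pos-* (ℚ.↧ₙ q₁) Subset.∣ U ∣)))
      (ℤ.≤-trans (ℤ.*-monoʳ-≤-nonNeg (+ suc k) 1≤↥q₁) (ℤ.<⇒≤ (<-fraction Subset.∣ U ∣ k
        (ℚ.≤-<-trans (ℚ.≮⇒≥ λ q<q₁ → q∉ (down (ext δ) q<q₁ q₁∈)) (ℚ.<-trans q<r r<∣U∣/k))))))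

-- Transfer to the progression and conclusion

module Progression (p : ℤ[x]) (n* b₀ : ℕ) {ℓ k} (R : Poly ℓ k) (K E : ℕ)
  (p≡    : ∀ t → eval p (+ (n* + t)) ≡ + (b₀ + t ℕ.* ⟦ R ⟧ t))
  (n*≢0  : NonZero n*) (c≢0 : NonZero (constantTerm R)) (E≢0 : NonZero E)
  (meet  : DenseSumsMeet K ⟦ Normalisation.q (normalise R E) ⟧) where

  open Normalisation (normalise R E) using (q; q-scaled)

  c d : ℕ
  c = constantTerm R
  d = c ℕ.* (c ℕ.* E)

  d≢0 : NonZero d
  d≢0 = ℕ.m*n≢0 c (c ℕ.* E) {{c≢0}} {{ℕ.m*n≢0 c E {{c≢0}} {{E≢0}}}}

  module _ (b : ℕ) (b₀≡2b : b₀ ≡ b ℕ.* 2) where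

    value : ∀ y z m → y + z ≡ ⟦ q ⟧ m → + (b + y ℕ.* d + (b + z ℕ.* d)) ≡ eval p (+ (n* + c ℕ.* E ℕ.* m))
    value y z m eq = sym (trans (p≡ (c ℕ.* E ℕ.* m)) (cong +_ (begin
      b₀ + c ℕ.* E ℕ.* m ℕ.* ⟦ R ⟧ (c ℕ.* E ℕ.* m)    ≡⟨ cong (b₀ ℕ.+_) (q-scaled m) ⟨
      b₀ + d ℕ.* ⟦ q ⟧ m                              ≡⟨ cong₂ (λ b v → b + d ℕ.* v) b₀≡2b (sym eq) ⟩
      b ℕ.* 2 + d ℕ.* (y + z)                         ≡⟨ split b d y z ⟩
      b + y ℕ.* d + (b + z ℕ.* d)                     ∎)))
      where
      open ≡-Reasoning
      split : ∀ b d y z → b ℕ.* 2 + d ℕ.* (y + z) ≡ b + y ℕ.* d + (b + z ℕ.* d)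
      split = ℕ-Ring.solve-∀

    sum-value : (A : Pred ℕ 0ℓ) → DenseInProgression K A b d →
      ∃[ x ] ∃[ y ] (x ∈ A × y ∈ A × x ≢ y × ∃[ n ] (NonZero n × + (x + y) ≡ eval p (+ n)))
    sum-value A dense with proj₁ meet | proj₂ meet
    ... | N₀ | solve with dense N₀
    ...   | k , N₀≤k , U , U⊆A , large
      -- The leading `false` shifts the indices by one, so that `y` stands for the point `b + y d`
      -- and `y = 0` is excluded.
      with solve (suc k) Subset.∣ U ∣ (member (false ∷ U)) (ℕ.m≤n⇒m≤1+n N₀≤k) (λ y y∈ → ℕ.s≤s⁻¹ (member-< (false ∷ U) y y∈)) (λ W → ∑-member (false ∷ U)) large
    ...     | suc y , suc z , m , y∈ , z∈ , y≢z , eq with member⇒∈ U y y∈ | member⇒∈ U z z∈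
    ...       | i , i∈U , refl | j , j∈U , refl =
      _ , _ , U⊆A i∈U , U⊆A j∈U ,
      (λ x≡y → y≢z (ℕ.*-cancelʳ-≡ (suc (toℕ i)) (suc (toℕ j)) d {{d≢0}} (ℕ.+-cancelˡ-≡ b _ _ x≡y))) ,
      n* + c ℕ.* E ℕ.* m , ℕ.≢-nonZero (λ n≡0 → ℕ.≢-nonZero⁻¹ n* {{n*≢0}} (ℕ.m+n≡0⇒m≡0 n* n≡0)) ,
      value (suc (toℕ i)) (suc (toℕ j)) m eq

expansion-at-even-value : ∀ p → TendsTo+∞ (eval p) → ∃[ n ] (NonZero n × + 2 ∣ eval p (+ n)) →
  ∃[ n* ] ∃[ b ] ∃[ ℓ ] ∃[ k ] ∃[ R ] (NonZero n* × NonZero b × NonZero ℓ × NonZero (constantTerm {ℓ} {k} R) ×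
    (∀ t → eval p (+ (n* + t)) ≡ + (b ℕ.* 2 + t ℕ.* ⟦ R ⟧ t)))
expansion-at-even-value p tends (n₀ , n₀≢0 , even) with tendsTo+∞⇒positiveLead p tends
... | a , p′ , ℓ , k , refl , pos with taylor pos
...   | n₁ , expand = from-expansion (expand n* n₁≤n*)
  where
  j n* : ℕ
  j  = n₁ + suc ℤ.∣ a ∣
  -- An even displacement preserves the parity of the value, and `j` is large enough for the
  -- expansion at `n*` to have natural coefficients.
  n* = n₀ + 2 ℕ.* j
  j≤n* : j ℕ.≤ n*
  j≤n* = ℕ.≤-trans (ℕ.m≤n*m j 2) (ℕ.m≤n+m (2 ℕ.* j) n₀)
  n₁≤n* : n₁ ℕ.≤ n*
  n₁≤n* = ℕ.≤-trans (ℕ.m≤m+n n₁ _) j≤n*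
  from-expansion : ∃[ q ] (1 ℕ.≤ constantTerm {ℓ} {k} q × (∀ t → eval p′ (+ (n* + t)) ≡ + ⟦ q ⟧ t)) →
    ∃[ n* ] ∃[ b ] ∃[ ℓ ] ∃[ k ] ∃[ R ] (NonZero n* × NonZero b × NonZero ℓ × NonZero (constantTerm {ℓ} {k} R) ×
      (∀ t → eval (a ∷ p′) (+ (n* + t)) ≡ + (b ℕ.* 2 + t ℕ.* ⟦ R ⟧ t)))
  from-expansion (q , 1≤q , q≡) with taylor-cons a p′ n* q (ℕ.≤-trans (ℕ.m≤n+m (suc ℤ.∣ a ∣) n₁) j≤n*) 1≤q q≡
  ... | b₀ , 1≤b₀ , p≡ with b₀-even
    where
    b₀-even : 2 ∣ℕ b₀
    b₀-even = subst (λ v → + 2 ∣ v) (trans (cong (λ x → eval (a ∷ p′) x) n₀+2j≡)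
        (trans (p≡ 0) (cong +_ (ℕ.+-identityʳ b₀))))
      (even-translate (a ∷ p′) (+ n₀) (+ j) even)
      where
      n₀+2j≡ : + n₀ ℤ.+ + 2 ℤ.* + j ≡ + (n* + 0)
      n₀+2j≡ = trans (cong (λ y → + n₀ ℤ.+ y) (sym (ℤ.pos-* 2 j))) (cong +_ (sym (ℕ.+-identityʳ n*)))
  ...   | ℕ∣.divides b refl = n* , b , ℓ , k , linearShift n* q ,
    ℕ.≢-nonZero (λ n*≡0 → ℕ.≢-nonZero⁻¹ n₀ {{n₀≢0}} (ℕ.m+n≡0⇒m≡0 n₀ n*≡0)) ,
    ℕ.m*n≢0⇒m≢0 b {{ℕ.>-nonZero 1≤b₀}} ,
    positiveLead⇒NonZero pos ,
    ℕ.>-nonZero (ℕ.≤-trans 1≤q (constantTerm-linearShift n* q)) ,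
    p≡

theorem1p6 : (δ : ℝ) → 0ᵉ <ᵉ ext δ →
    (p : ℤ[x]) → TendsTo+∞ (eval p) →
    ∃[ n ] (NonZero n × + 2 ∣ eval p (+ n)) →
    ∃[ b ] ∃[ d ] (NonZero b × NonZero d ×
    ((A : Pred ℕ 0ℓ) → A ⊆ NonZero →
    ext δ <ᵉ upperDensity b d A →
    ∃[ x ] ∃[ y ] (x ∈ A × y ∈ A × x ≢ y ×
    ∃[ n ] (NonZero n × + (x + y) ≡ eval p (+ n)))))
theorem1p6 δ 0<δ p tends even with upperDensity⇒dense δ 0<δ | expansion-at-even-value p tends even
... | K , K≢0 , dense | n* , b , ℓ , k , R , n*≢0 , b≢0 , ℓ≢0 , c≢0 , p≡ = conclude (normalised-dense-sums R K ℓ≢0 c≢0 K≢0)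
  where
  conclude : ∃[ E ] (NonZero E × DenseSumsMeet K ⟦ Normalisation.q (normalise R E) ⟧) → _
  conclude (E , E≢0 , meet) = b , d , b≢0 , d≢0 , λ A _ δ<density → sum-value b refl A (dense A b d δ<density)
    where open Progression p n* (b ℕ.* 2) R K E p≡ n*≢0 c≢0 E≢0 meet
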